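{- (i) Let $n>1$ be an odd integer. Then there is no positive integer $m$ with $(f(m),d(m))=(n,2n)$, and there is no positive integer $m$ with $(f(m),d(m))=(n,4n)$. (ii) Let $L$ be a Linnik constant. There is a constant $C>0$ (depending only on $L$) such that for all odd primes $p,q$ with $p<q$, $p\mid q-1$ and $p^2\nmid q-1$, there exists a positive integer $m\le C\,p\,(pq)^{L+1}$ with $f(m)=q$ and $d(m)=pq$.
   Context: For a positive integer $m$, let $\varphi(m)$ be Euler's function and $\lambda(m)$ the Carmichael function (the exponent of the multiplicative group $(\mathbb{Z}/m\mathbb{Z})^*$). Let $\mathrm{rad}(m)$ be the product of the distinct primes dividing $m$. Let $\delta=2$ if $4\mid m$ and $\delta=1$ otherwise. Define $$ d(m)=\gcd\big(m,\ \delta\,\varphi(\mathrm{rad}(m))\big),\qquad f(m)=\gcd\big(m,\ \delta\,\lambda(m)\varphi(\mathrm{rad}(m))/\varphi(m)\big). $$ A Linnik constant is a positive number $L$ such that there is an absolute constant $c>0$ with the property that for all integers $1\le a<q$ with $\gcd(a,q)=1$, the smallest prime $p(a,q)$ in the progression $\{a+jq: j\ge 0\}$ satisfies $p(a,q)\le c\, q^L$ (such $L$ exist by Linnik's theorem; e.g. $L=5$ works). -}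

module Defs where

open import Data.Bool.Base using (if_then_else_)
open import Data.Fin using (Fin; toℕ; fromℕ<)
open import Data.Fin.Properties using (pigeonhole; toℕ<n; toℕ-fromℕ<)
open import Data.Integer.Base using (+_)
open import Data.List.Base using (length; filter; applyUpTo; upTo)
open import Data.List.Properties using (filter-accept)
open import Data.Nat
open import Data.Nat.Coprimality as Coprime using (Coprime; coprime?; coprime-divisor)
open import Data.Nat.Divisibility
open import Data.Nat.DivMod
open import Data.Nat.GCD using (gcd)
open import Data.Nat.ListAction using (product)
open import Data.Nat.Primality using (Prime; prime?)
open import Data.Nat.Properties
open import Data.Product.Base using (∃; ∃-syntax; _×_; _,_; proj₁)
open import Data.Rational.Unnormalised.Base as ℚ using (ℚᵘ; mkℚᵘ)
import Data.Rational.Unnormalised.Properties as ℚ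
open import Data.Rational.Unnormalised.Solver using (module +-*-Solver)
open import Data.Sum.Base using (inj₁; inj₂)
open import Function.Base using (_∘_)
open import Relation.Binary.PropositionalEquality
open import Relation.Nullary.Decidable using (Dec; does; yes; no; _×-dec_; _→-dec_)
open import Relation.Nullary.Negation using (contradiction)

φ : ℕ → ℕ
φ m = length (filter (λ k → coprime? k m) (applyUpTo suc m))

rad : ℕ → ℕ
rad m = product (filter (λ p → prime? p ×-dec p ∣? m) (upTo (suc m)))

φ-nonZero : ∀ m .{{_ : NonZero m}} → NonZero (φ m)
φ-nonZero (suc m) = subst (NonZero ∘ length)
  (sym (filter-accept (λ k → coprime? k (suc m)) {xs = applyUpTo (suc ∘ suc) m}
    (Coprime.1-coprimeTo (suc m))))
  _

-- The elements of (ℤ/mℤ)* are represented by the residues a < m coprime to m.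
Annihilates : (m : ℕ) .{{_ : NonZero m}} → ℕ → Set
Annihilates m e = ∀ {a} → a < m → Coprime a m → (a ^ e) % m ≡ 1 % m

IsExponent : (m : ℕ) .{{_ : NonZero m}} → ℕ → Set
IsExponent m e =
  0 < e × Annihilates m e × (∀ {e′} → 0 < e′ → Annihilates m e′ → e ≤ e′)

private

  annihilates? : ∀ m .{{_ : NonZero m}} e → Dec (Annihilates m e)
  annihilates? m e =
    allUpTo? (λ a → coprime? a m →-dec ((a ^ e) % m ≟ 1 % m)) m

  ≡%⇒∣∸ : ∀ x y m .{{_ : NonZero m}} → x % m ≡ y % m → m ∣ y ∸ x
  ≡%⇒∣∸ x y m eq = divides (y / m ∸ x / m) (begin
    y ∸ x                                       ≡⟨ cong₂ _∸_ (m≡m%n+[m/n]*n y m) (m≡m%n+[m/n]*n x m) ⟩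
    (y % m + y / m * m) ∸ (x % m + x / m * m)   ≡⟨ cong (λ z → (y % m + y / m * m) ∸ (z + x / m * m)) eq ⟩
    (y % m + y / m * m) ∸ (y % m + x / m * m)   ≡⟨ [m+n]∸[m+o]≡n∸o (y % m) _ _ ⟩
    y / m * m ∸ x / m * m                       ≡⟨ *-distribʳ-∸ m (y / m) (x / m) ⟨
    (y / m ∸ x / m) * m                         ∎)
    where open ≡-Reasoning

  cancel-^ : ∀ {a m} → Coprime a m → ∀ i {o} → m ∣ a ^ i * o → m ∣ o
  cancel-^ c zero    {o} m∣ = subst (_ ∣_) (*-identityˡ o) m∣
  cancel-^ {a} {m} c (suc i) {o} m∣ =
    cancel-^ c i (coprime-divisor (Coprime.sym c) (subst (m ∣_) (*-assoc a (a ^ i) o) m∣))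

  order : ∀ {a m} .{{_ : NonZero m}} → Coprime a m →
          ∃[ k ] 0 < k × k ≤ m × (a ^ k) % m ≡ 1 % m
  order {a} {m} c with pigeonhole (n<1+n m) (λ (i : Fin (suc m)) → fromℕ< (m%n<n (a ^ toℕ i) m))
  ... | i , j , i<j , fi≡fj = k , m<n⇒0<n∸m i<j , ≤-trans (m∸n≤m (toℕ j) (toℕ i)) (s≤s⁻¹ (toℕ<n j)) , conclude a c m∣
    where
    k = toℕ j ∸ toℕ i

    powers : (a ^ toℕ i) % m ≡ (a ^ toℕ j) % m
    powers = trans (sym (toℕ-fromℕ< _)) (trans (cong toℕ fi≡fj) (toℕ-fromℕ< _))

    split : a ^ toℕ j ∸ a ^ toℕ i ≡ a ^ toℕ i * (a ^ k ∸ 1)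
    split = begin
      a ^ toℕ j ∸ a ^ toℕ i                  ≡⟨ cong (λ z → a ^ z ∸ a ^ toℕ i) (m+[n∸m]≡n (<⇒≤ i<j)) ⟨
      a ^ (toℕ i + k) ∸ a ^ toℕ i            ≡⟨ cong₂ _∸_ (^-distribˡ-+-* a (toℕ i) k) (sym (*-identityʳ (a ^ toℕ i))) ⟩
      a ^ toℕ i * a ^ k ∸ a ^ toℕ i * 1      ≡⟨ *-distribˡ-∸ (a ^ toℕ i) (a ^ k) 1 ⟨
      a ^ toℕ i * (a ^ k ∸ 1)                ∎
      where open ≡-Reasoning

    m∣ : m ∣ a ^ k ∸ 1
    m∣ = cancel-^ c (toℕ i) (subst (m ∣_) split (≡%⇒∣∸ (a ^ toℕ i) (a ^ toℕ j) m powers))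

    conclude : ∀ a → Coprime a m → m ∣ a ^ k ∸ 1 → (a ^ k) % m ≡ 1 % m
    conclude zero c _ with refl ← c {m} (m ∣0 , ∣-refl) = trans (n%1≡0 (0 ^ k)) refl
    conclude a@(suc _) _ m∣ = trans
      (cong (_% m) (sym (m+[n∸m]≡n (m^n>0 a k))))
      (%-remove-+ʳ 1 m∣)

  ^-% : ∀ x t m .{{_ : NonZero m}} → x % m ≡ 1 % m → (x ^ t) % m ≡ 1 % m
  ^-% x zero    m eq = refl
  ^-% x (suc t) m eq = begin
    (x * x ^ t) % m                  ≡⟨ %-distribˡ-* x (x ^ t) m ⟩
    ((x % m) * ((x ^ t) % m)) % m    ≡⟨ cong₂ (λ y z → (y * z) % m) eq (^-% x t m eq) ⟩
    ((1 % m) * (1 % m)) % m          ≡⟨ %-distribˡ-* 1 1 m ⟨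
    1 % m                            ∎
    where open ≡-Reasoning

  m!-annihilates : ∀ m .{{_ : NonZero m}} → Annihilates m (m !)
  m!-annihilates m {a} _ c with order c
  ... | suc k , _ , k≤m , eq with ∣-trans (m∣m*n (k !)) (m≤n⇒m!∣n! k≤m)
  ...   | divides t m!≡ = begin
    (a ^ (m !)) % m             ≡⟨ cong (λ z → (a ^ z) % m) (trans m!≡ (*-comm t (suc k))) ⟩
    (a ^ (suc k * t)) % m     ≡⟨ cong (_% m) (^-*-assoc a (suc k) t) ⟨
    ((a ^ suc k) ^ t) % m     ≡⟨ ^-% (a ^ suc k) t m eq ⟩
    1 % m                     ∎
    where open ≡-Reasoning

  search : ∀ m .{{_ : NonZero m}} e n →
           (∀ {e′} → 0 < e′ → Annihilates m e′ → e ≤ e′) →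
           0 < e → Annihilates m (n + e) → ∃ (IsExponent m)
  search m e zero    below 0<e ann = e , 0<e , ann , below
  search m e (suc n) below 0<e ann with annihilates? m e
  ... | yes ann′ = e , 0<e , ann′ , below
  ... | no ¬ann′ = search m (suc e) n below′ z<s
          (subst (Annihilates m) (sym (+-suc n e)) ann)
    where
    below′ : ∀ {e′} → 0 < e′ → Annihilates m e′ → suc e ≤ e′
    below′ 0<e′ ann′ with m≤n⇒m<n∨m≡n (below 0<e′ ann′)
    ... | inj₁ e<e′ = e<e′
    ... | inj₂ refl = contradiction (λ {a} → ann′ {a}) ¬ann′

abstract
  exponent : ∀ m .{{_ : NonZero m}} → ∃ (IsExponent m)
  exponent m = search m 1 (m ! ∸ 1) (λ 0<e _ → 0<e) z<s
    (subst (Annihilates m) (sym (m∸n+n≡m (1≤n! m))) (m!-annihilates m))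

carmichael : (m : ℕ) .{{_ : NonZero m}} → ℕ
carmichael m = proj₁ (exponent m)

δ : ℕ → ℕ
δ m = if does (4 ∣? m) then 2 else 1

d : ℕ → ℕ
d m = gcd m (δ m * φ (rad m))

-- The division is exact: φ(m)/φ(rad m) = m/rad m, and every odd prime power
-- p^(a-1) with p^a ∣ m divides λ(m), as does 2^(a-2) if a ≥ 2; the factor δ
-- makes up for the missing 2.
f : (m : ℕ) .{{_ : NonZero m}} → ℕ
f m = gcd m ((δ m * carmichael m * φ (rad m)) / φ m)
  where instance _ = φ-nonZero m

1/[1+_] : ℕ → ℚᵘ
1/[1+ n ] = mkℚᵘ (+ 1) n

-- Real numbers as regular sequences of rationals, |x_m - x_n| ≤ 1/(m+1) + 1/(n+1).
record ℝ : Set where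
  field
    seq     : ℕ → ℚᵘ
    regular : ∀ m n → ℚ.∣ seq m ℚ.- seq n ∣ ℚ.≤ 1/[1+ m ] ℚ.+ 1/[1+ n ]

open ℝ public

infix 4 _<ᵣ_ _≤ᵣ_·_^ᵣ_
infixl 6 _⊕_
infixr 7 _⊛_

Positive : ℝ → Set
Positive x = ∃[ n ] 1/[1+ n ] ℚ.< seq x n

_<ᵣ_ : ℝ → ℚᵘ → Set
x <ᵣ r = ∃[ n ] seq x n ℚ.+ 1/[1+ n ] ℚ.< r

_⊕_ : ℝ → ℕ → ℝ
seq     (x ⊕ k) n = seq x n ℚ.+ + k ℚ./ 1
regular (x ⊕ k) m n = ℚ.≤-trans
  (ℚ.≤-reflexive (ℚ.∣-∣-cong
    (solve 3 (λ a b t → (a :+ t) :- (b :+ t) := a :- b) ℚ.≃-refl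
      (seq x m) (seq x n) (+ k ℚ./ 1))))
  (regular x m n)
  where open +-*-Solver

private
  k/[k*[1+n]] : ∀ k n → + suc k ℚ./ 1 ℚ.* 1/[1+ pred (suc k * suc n) ] ℚ.≃ 1/[1+ n ]
  k/[k*[1+n]] k n = ℚ.*≡* (cong +_ (begin
    suc k * 1 * suc n           ≡⟨ cong (_* suc n) (*-identityʳ (suc k)) ⟩
    suc k * suc n               ≡⟨ *-identityˡ (suc k * suc n) ⟨
    1 * (suc k * suc n)         ≡⟨ cong (1 *_) (*-identityˡ (suc k * suc n)) ⟨
    1 * (1 * (suc k * suc n))   ∎))
    where open ≡-Reasoning

-- Multiplication by k; the k-fold error is absorbed by reading the
-- approximation of x with error 1/(k(n+1)).
_⊛_ : ℕ → ℝ → ℝ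
seq     (k ⊛ x) n = + k ℚ./ 1 ℚ.* seq x (pred (k * suc n))
regular (zero ⊛ x) m n = ℚ.≤-trans
  (ℚ.≤-reflexive (ℚ.∣-∣-cong
    (solve 2 (λ a b → con ℚ.0ℚᵘ :* a :- con ℚ.0ℚᵘ :* b := con ℚ.0ℚᵘ) ℚ.≃-refl
      (seq x 0) (seq x 0))))
  (ℚ.nonNegative⁻¹ (1/[1+ m ] ℚ.+ 1/[1+ n ]))
  where open +-*-Solver
regular (k@(suc k-1) ⊛ x) m n = begin
  ℚ.∣ K ℚ.* a ℚ.- K ℚ.* b ∣       ≃⟨ ℚ.∣-∣-cong (solve 3 (λ t y z → t :* y :- t :* z := t :* (y :- z)) ℚ.≃-refl K a b) ⟩
  ℚ.∣ K ℚ.* (a ℚ.- b) ∣           ≃⟨ ℚ.∣p*q∣≃∣p∣*∣q∣ K (a ℚ.- b) ⟩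
  K ℚ.* ℚ.∣ a ℚ.- b ∣             ≤⟨ ℚ.*-monoʳ-≤-nonNeg K (regular x i j) ⟩
  K ℚ.* (1/[1+ i ] ℚ.+ 1/[1+ j ])      ≃⟨ ℚ.*-distribˡ-+ K 1/[1+ i ] 1/[1+ j ] ⟩
  K ℚ.* 1/[1+ i ] ℚ.+ K ℚ.* 1/[1+ j ]  ≃⟨ ℚ.+-cong (k/[k*[1+n]] k-1 m) (k/[k*[1+n]] k-1 n) ⟩
  1/[1+ m ] ℚ.+ 1/[1+ n ]               ∎
  where
  open ℚ.≤-Reasoning
  open +-*-Solver using (solve; _:*_; _:-_; _:=_)
  K = + k ℚ./ 1
  i = pred (k * suc m)
  j = pred (k * suc n)
  a = seq x i
  b = seq x j

-- n ≤ c b^L for c, L > 0 and b ≥ 1.  As c b^L is the infimum of s b^r over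
-- rationals s = u/v > c and r = a/e > L, this says n ≤ (u/v) b^(a/e) for all
-- such s and r, i.e. (n v)^e ≤ u^e b^a.
_≤ᵣ_·_^ᵣ_ : ℕ → ℝ → ℕ → ℝ → Set
n ≤ᵣ c · b ^ᵣ L =
  ∀ (u v a e : ℕ) .{{_ : NonZero v}} .{{_ : NonZero e}} →
  c <ᵣ + u ℚ./ v → L <ᵣ + a ℚ./ e →
  (n * v) ^ e ≤ u ^ e * b ^ a

IsLeastPrimeIn : (a q P : ℕ) → Set
IsLeastPrimeIn a q P =
  Prime P × (∃[ j ] P ≡ a + j * q) × (∀ j → Prime (a + j * q) → P ≤ a + j * q)

-- The existence of p(a,q), which holds by Dirichlet's theorem, is part of the
-- condition, so that it makes sense without that theorem.
IsLinnikConstant : ℝ → Set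
IsLinnikConstant L =
  Positive L ×
  ∃[ c ] Positive c ×
    (∀ a q → 1 ≤ a → a < q → Coprime a q →
      ∃[ P ] IsLeastPrimeIn a q P × P ≤ᵣ c · q ^ᵣ L)

{-# OPTIONS --safe #-}

-- (i) Let s be an odd prime factor of n.  As s divides φ(rad m), it divides
-- t - 1 for another odd prime factor t of m, so 4 ∣ φ(rad m).  Hence 8 ∣ m
-- would give 8 ∣ d(m), which is 2n or 4n.  So m = 2δ(m)k with k odd; writing
-- m = δ(m) c rad(m), where c is odd and divides λ(m), the second argument of
-- the gcd defining f(m) is λ(m)/c.  It is even, as λ(m) is, and so f(m) is even.
--
-- (ii) Take m = p²qr with r the least prime congruent to q + 1 modulo pq.
-- Then r ≡ 1 (mod q) and r ≡ 2 (mod p).  Hence p divides λ(m) and φ(rad m) =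
-- (p-1)(q-1)(r-1) exactly once, q divides both because it divides r - 1, and
-- r divides neither, while φ(m) = p φ(rad m).

module Submission where

open import Defs
open import Data.Bool.Base using (true; false; if_then_else_)
import Data.Integer.Base as ℤ
import Data.Integer.Properties as ℤ
import Data.Integer.Solver as ℤ
open import Data.List.Base using (List; []; _∷_; length; filter; map; applyUpTo; upTo; replicate; _++_; _∷ʳ_)
open import Data.List.Membership.Propositional using (_∈_)
open import Data.List.Membership.Propositional.Properties using (∈-map⁺; ∈-filter⁺; ∈-filter⁻; ∈-upTo⁺)
open import Data.List.Properties using (applyUpTo-∷ʳ; length-++; filter-++; length-replicate)
open import Data.List.Relation.Unary.All as All using (All; []; _∷_)
open import Data.List.Relation.Unary.All.Properties using (all-filter)
open import Data.List.Relation.Unary.Any using (here; there)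
open import Data.List.Relation.Unary.Unique.Propositional using (Unique; []; _∷_)
open import Data.List.Relation.Unary.Unique.Propositional.Properties using (filter⁺; upTo⁺)
open import Data.Nat
open import Data.Nat.Combinatorics
  using (nCn≡1; nCk≡n!/k![n-k]!; k![n∸k]!∣n!; nCk+nC[k+1]≡[n+1]C[k+1]; k>n⇒nCk≡0)
  renaming (_C_ to infixl 8 _choose_)
open import Data.Nat.Coprimality as Coprime using (Coprime; coprime?; coprime-divisor)
open import Data.Nat.Divisibility
open import Data.Nat.DivMod
open import Data.Nat.GCD using (gcd; gcd[m,n]∣m; gcd[m,n]∣n; gcd-greatest; c*gcd[m,n]≡gcd[cm,cn])
open import Data.Nat.ListAction using (product)
open import Data.Nat.ListAction.Properties using (∈⇒∣product)
open import Data.Nat.Primality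
open import Data.Nat.Primality.Factorisation
open import Data.Nat.Properties
open import Data.Nat.Solver using (module +-*-Solver)
open import Data.Product using (∃-syntax; Σ-syntax; _×_; _,_; proj₁; proj₂)
open import Data.Rational.Unnormalised.Base as ℚ using (mkℚᵘ)
import Data.Rational.Unnormalised.Properties as ℚ
import Data.Rational.Unnormalised.Solver as ℚ
open import Data.Sum.Base using (inj₁; inj₂)
open import Function.Base using (_∘_; case_of_)
open import Function.Bundles using (_⇔_; mk⇔; Equivalence)
open import Level using (0ℓ)
open import Relation.Binary.PropositionalEquality
open import Relation.Nullary.Decidable using (Dec; dec-true; dec-false; does; yes; no; _×-dec_; ¬?)
open import Relation.Nullary.Negation using (¬_; contradiction)
open import Relation.Unary using (Pred; Decidable)

-- Real bounds

-- Lower bounds for λ(m), which is given only as a least exponent, come from explicit units rather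
-- than from the structure of the unit group: -1 shows that λ(m) is even, 1 + rad m that the odd
-- number c divides it, and a count of polynomial roots modulo r that r - 1 divides it. Oddness of c
-- matters because raising to an odd prime power p gains exactly one factor p, whereas squaring may
-- gain more: 3² = 1 + 8. In (ii) the square p² is what separates f from d. Dividing by φ(m) = p
-- φ(rad m) removes the only factor p of λ(m) from the second argument of f, while d keeps the only
-- p of φ(rad m). The residue q + 1 lets r - 1 supply q without supplying another p. Since m = (pq)
-- p r and r ≤ c (pq)^L, the constant C is the constant c of L itself.

p≤∣p∣ : ∀ p → p ℚ.≤ ℚ.∣ p ∣
p≤∣p∣ p with ℚ.≤-total ℚ.0ℚᵘ p
... | inj₁ 0≤p = ℚ.≤-reflexive (ℚ.≃-sym (ℚ.0≤p⇒∣p∣≃p 0≤p))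
... | inj₂ p≤0 = ℚ.≤-trans p≤0 (ℚ.0≤∣p∣ p)

-- Regularity carries the single index `k` that witnesses positivity to every `n`: `seq x n` falls
-- below `seq x k` by at most 1/(k+1) + 1/(n+1).
positive⇒0<seq+ : ∀ x → Positive x → ∀ n → ℚ.0ℚᵘ ℚ.< seq x n ℚ.+ 1/[1+ n ]
positive⇒0<seq+ x (k , 1/k<xₖ) n = begin-strict
  ℚ.0ℚᵘ                                      ≃⟨ ℚ.+-inverseʳ 1/[1+ k ] ⟨
  1/[1+ k ] ℚ.- 1/[1+ k ]                    <⟨ ℚ.+-monoˡ-< (ℚ.- 1/[1+ k ]) 1/k<xₖ ⟩
  xₖ ℚ.- 1/[1+ k ]                           ≃⟨ solve 3 (λ a b t → a :- t := (a :- b) :+ (b :- t)) ℚ.≃-refl xₖ xₙ 1/[1+ k ] ⟩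
  (xₖ ℚ.- xₙ) ℚ.+ (xₙ ℚ.- 1/[1+ k ])         ≤⟨ ℚ.+-monoˡ-≤ (xₙ ℚ.- 1/[1+ k ]) (ℚ.≤-trans (p≤∣p∣ (xₖ ℚ.- xₙ)) (regular x k n)) ⟩
  (1/[1+ k ] ℚ.+ 1/[1+ n ]) ℚ.+ (xₙ ℚ.- 1/[1+ k ]) ≃⟨ solve 3 (λ b s t → (t :+ s) :+ (b :- t) := b :+ s) ℚ.≃-refl xₙ 1/[1+ n ] 1/[1+ k ] ⟩
  xₙ ℚ.+ 1/[1+ n ]                           ∎
  where
  open ℚ.≤-Reasoning
  open ℚ.+-*-Solver using (solve; _:+_; _:-_; _:=_)
  xₖ = seq x k
  xₙ = seq x n

[d+n]/d≃n/d+1 : ∀ n d .{{_ : NonZero d}} → ℤ.+ (d + n) ℚ./ d ℚ.≃ ℤ.+ n ℚ./ d ℚ.+ ℚ.1ℚᵘ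
[d+n]/d≃n/d+1 n d@(suc e) = ℚ.*≡* (trans
  (cong (λ x → ℤ.+ (d + n) ℤ.* ℤ.+ suc x) (*-identityʳ e))
  (solve 2 (λ s t → (s :+ t) :* s := (t :* con (ℤ.+ 1) :+ con (ℤ.+ 1) :* s) :* s) refl (ℤ.+ d) (ℤ.+ n)))
  where open ℤ.+-*-Solver using (solve; con; _:+_; _:*_; _:=_)

-- Exponents in `_≤ᵣ_·_^ᵣ_` are fractions of natural numbers, so subtracting 1 from `a / e` must not
-- leave ℕ. Positivity of `x` gives 1 < a/e and hence e < a.
⊕1<⇒ : ∀ {x a e} .{{_ : NonZero e}} → Positive x → x ⊕ 1 <ᵣ ℤ.+ a ℚ./ e →
       ∃[ a′ ] a ≡ e + a′ × x <ᵣ ℤ.+ a′ ℚ./ e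
⊕1<⇒ {x} {a} {suc e} x>0 (n , x+1<a/e) = a′ , sym a≡ , n , (begin-strict
  y                                 ≃⟨ solve 1 (λ y → y := (y :+ con ℚ.1ℚᵘ) :- con ℚ.1ℚᵘ) ℚ.≃-refl y ⟩
  y ℚ.+ ℚ.1ℚᵘ ℚ.- ℚ.1ℚᵘ             <⟨ ℚ.+-monoˡ-< (ℚ.- ℚ.1ℚᵘ) y+1<a/e ⟩
  mkℚᵘ (ℤ.+ a) e ℚ.- ℚ.1ℚᵘ            ≃⟨ ℚ.+-congˡ (ℚ.- ℚ.1ℚᵘ) a/e≃ ⟩
  mkℚᵘ (ℤ.+ a′) e ℚ.+ ℚ.1ℚᵘ ℚ.- ℚ.1ℚᵘ ≃⟨ solve 1 (λ y → (y :+ con ℚ.1ℚᵘ) :- con ℚ.1ℚᵘ := y) ℚ.≃-refl (mkℚᵘ (ℤ.+ a′) e) ⟩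
  mkℚᵘ (ℤ.+ a′) e                     ∎)
  where
  open ℚ.≤-Reasoning
  open ℚ.+-*-Solver using (solve; con; _:+_; _:-_; _:=_)
  y = seq x n ℚ.+ 1/[1+ n ]
  a′ = a ∸ suc e

  y+1<a/e : y ℚ.+ ℚ.1ℚᵘ ℚ.< mkℚᵘ (ℤ.+ a) e
  y+1<a/e = ℚ.<-respˡ-≃ (solve 2 (λ s t → (s :+ con ℚ.1ℚᵘ) :+ t := (s :+ t) :+ con ℚ.1ℚᵘ) ℚ.≃-refl (seq x n) 1/[1+ n ]) x+1<a/e

  1<a/e : ℚ.1ℚᵘ ℚ.< mkℚᵘ (ℤ.+ a) e
  1<a/e = ℚ.<-trans (ℚ.<-respˡ-≃ (ℚ.+-identityˡ ℚ.1ℚᵘ) (ℚ.+-monoˡ-< ℚ.1ℚᵘ (positive⇒0<seq+ x x>0 n))) y+1<a/e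

  e<a : suc e < a
  e<a = ℤ.drop‿+<+ (subst₂ ℤ._<_ (ℤ.*-identityˡ (ℤ.+ suc e)) (ℤ.*-identityʳ (ℤ.+ a)) (ℚ.drop-*<* 1<a/e))

  a≡ : suc e + a′ ≡ a
  a≡ = m+[n∸m]≡n (<⇒≤ e<a)

  a/e≃ : mkℚᵘ (ℤ.+ a) e ℚ.≃ mkℚᵘ (ℤ.+ a′) e ℚ.+ ℚ.1ℚᵘ
  a/e≃ = subst (λ x → mkℚᵘ (ℤ.+ x) e ℚ.≃ mkℚᵘ (ℤ.+ a′) e ℚ.+ ℚ.1ℚᵘ) a≡ ([d+n]/d≃n/d+1 a′ (suc e))

*-pos-rotate : ∀ x y z → (ℤ.+ x ℤ.* ℤ.+ y) ℤ.* ℤ.+ z ≡ ℤ.+ y ℤ.* ℤ.+ (1 * (x * z))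
*-pos-rotate x y z = trans (solve 3 (λ x y z → (x :* y) :* z := y :* (x :* z)) refl (ℤ.+ x) (ℤ.+ y) (ℤ.+ z))
  (cong (ℤ.+ y ℤ.*_) (trans (sym (ℤ.pos-* x z)) (cong ℤ.+_ (sym (*-identityˡ (x * z))))))
  where open ℤ.+-*-Solver using (solve; _:*_; _:=_)

-- The witness is the index at which `k ⊛ x` reads `x`: the error there is 1/(k(n+1)), and `k` times
-- it is the error 1/(n+1) of the hypothesis.
⊛<⇒ : ∀ {k x u v} .{{_ : NonZero k}} .{{_ : NonZero v}} .{{_ : NonZero (k * v)}} →
      k ⊛ x <ᵣ ℤ.+ u ℚ./ v → x <ᵣ ℤ.+ u ℚ./ (k * v)
⊛<⇒ {k@(suc _)} {x} {u} {v@(suc _)} (n , kx<u/v) = i , ℚ.*-cancelˡ-<-nonNeg K (begin-strict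
  K ℚ.* (seq x i ℚ.+ 1/[1+ i ])             ≃⟨ ℚ.*-distribˡ-+ K (seq x i) 1/[1+ i ] ⟩
  K ℚ.* seq x i ℚ.+ K ℚ.* 1/[1+ i ]         ≃⟨ ℚ.+-congʳ (K ℚ.* seq x i) (ℚ.*≡* (*-pos-rotate k 1 (suc n))) ⟩
  K ℚ.* seq x i ℚ.+ 1/[1+ n ]               <⟨ kx<u/v ⟩
  ℤ.+ u ℚ./ v                                 ≃⟨ ℚ.*≡* (*-pos-rotate k u v) ⟨
  K ℚ.* (ℤ.+ u ℚ./ (k * v))                   ∎)
  where
  open ℚ.≤-Reasoning
  i = pred (k * suc n)
  K = ℤ.+ k ℚ./ 1

^-distribʳ-* : ∀ m n o → (m * n) ^ o ≡ m ^ o * n ^ o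
^-distribʳ-* m n zero    = refl
^-distribʳ-* m n (suc o) = trans (cong (m * n *_) (^-distribʳ-* m n o))
  (solve 4 (λ m n x y → m :* n :* (x :* y) := m :* x :* (n :* y)) refl m n (m ^ o) (n ^ o))
  where open +-*-Solver using (solve; _:*_; _:=_)

-- Used with `b` = pq and `n` = r to bound m = pq · p · r. A fraction above y + 1 is 1 + a′/e with
-- a′/e above y, and u/v above p x gives u/(pv) above x; the hypothesis for these is then multiplied
-- by b^e.
≤ᵣ-scale : ∀ {n x b y} p .{{_ : NonZero p}} → Positive y →
           n ≤ᵣ x · b ^ᵣ y → b * p * n ≤ᵣ p ⊛ x · b ^ᵣ (y ⊕ 1)
≤ᵣ-scale {n} {x} {b} {y} p y>0 n≤ u v a e px<u/v y+1<a/e with a′ , refl , y<a′/e ← ⊕1<⇒ {x = y} y>0 y+1<a/e = begin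
  (b * p * n * v) ^ e         ≡⟨ cong (_^ e) (solve 4 (λ b p n v → b :* p :* n :* v := b :* (n :* (p :* v))) refl b p n v) ⟩
  (b * (n * (p * v))) ^ e     ≡⟨ ^-distribʳ-* b (n * (p * v)) e ⟩
  b ^ e * (n * (p * v)) ^ e   ≤⟨ *-monoʳ-≤ (b ^ e) (n≤ u (p * v) a′ e (⊛<⇒ {x = x} px<u/v) y<a′/e) ⟩
  b ^ e * (u ^ e * b ^ a′)    ≡⟨ solve 3 (λ x y z → x :* (y :* z) := y :* (x :* z)) refl (b ^ e) (u ^ e) (b ^ a′) ⟩
  u ^ e * (b ^ e * b ^ a′)    ≡⟨ cong (u ^ e *_) (^-distribˡ-+-* b e a′) ⟨
  u ^ e * b ^ (e + a′)        ∎
  where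
  open ≤-Reasoning
  open +-*-Solver using (solve; _:*_; _:=_)
  instance _ = m*n≢0 p v

open +-*-Solver using (solve; _:+_; _:*_; con; _:=_)

-- Primes and coprimality

primeDivisor : ∀ {n} → n ≢ 1 → ∃[ p ] Prime p × p ∣ n
primeDivisor {zero}  _   = 2 , prime[2] , 2 ∣0
primeDivisor {suc n} n≢1 with factorise (suc n)
... | record { factors = []    ; isFactorisation = eq } = contradiction eq n≢1
... | record { factors = p ∷ _ ; isFactorisation = eq ; factorsPrime = p-prime ∷ _ } =
  p , p-prime , subst (p ∣_) (sym eq) (m∣m*n _)

coprimeByPrimes : ∀ {m n} → (∀ {p} → Prime p → p ∣ m → p ∤ n) → Coprime m n
coprimeByPrimes {m} {n} h {k} (k∣m , k∣n) with k ≟ 1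
... | yes k≡1 = k≡1
... | no  k≢1 with p , p-prime , p∣k ← primeDivisor k≢1 =
  contradiction (∣-trans p∣k k∣n) (h p-prime (∣-trans p∣k k∣m))

prime⇒≢1 : ∀ {p} → Prime p → p ≢ 1
prime⇒≢1 p-prime refl = ¬prime[1] p-prime

coprime⇒∤ : ∀ {m n p} → Coprime m n → Prime p → p ∣ m → p ∤ n
coprime⇒∤ c p-prime p∣m p∣n = prime⇒≢1 p-prime (c (p∣m , p∣n))

coprime-*ʳ : ∀ {k m n} → Coprime k m → Coprime k n → Coprime k (m * n)
coprime-*ʳ {k} {m} {n} c c′ = coprimeByPrimes λ p-prime p∣k p∣mn →
  case euclidsLemma m n p-prime p∣mn of λ where
    (inj₁ p∣m) → coprime⇒∤ c p-prime p∣k p∣m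
    (inj₂ p∣n) → coprime⇒∤ c′ p-prime p∣k p∣n

coprime-∣ʳ : ∀ {k m n} → n ∣ m → Coprime k m → Coprime k n
coprime-∣ʳ n∣m c (j∣k , j∣n) = c (j∣k , ∣-trans j∣n n∣m)

coprime-*ˡ : ∀ {k m n} → Coprime k n → Coprime m n → Coprime (k * m) n
coprime-*ˡ c c′ = Coprime.sym (coprime-*ʳ (Coprime.sym c) (Coprime.sym c′))

coprime-∣ˡ : ∀ {k m n} → k ∣ m → Coprime m n → Coprime k n
coprime-∣ˡ k∣m c (j∣k , j∣n) = c (∣-trans j∣k k∣m , j∣n)

prime∤⇒coprime : ∀ {p m} → Prime p → p ∤ m → Coprime p m
prime∤⇒coprime p-prime p∤m (j∣p , j∣m) with prime⇒irreducible p-prime j∣p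
... | inj₁ j≡1  = j≡1
... | inj₂ refl = contradiction j∣m p∤m

∣⇒coprime-1+ : ∀ {m n} → m ∣ n → Coprime m (1 + n)
∣⇒coprime-1+ {n = n} m∣n {k} (k∣m , k∣1+n) =
  ∣1⇒≡1 (∣m+n∣m⇒∣n (subst (k ∣_) (+-comm 1 n) k∣1+n) (∣-trans k∣m m∣n))

prime∣prime⇒≡ : ∀ {p q} → Prime p → Prime q → p ∣ q → p ≡ q
prime∣prime⇒≡ p-prime q-prime p∣q with prime⇒irreducible q-prime p∣q
... | inj₁ p≡1 = contradiction p≡1 (prime⇒≢1 p-prime)
... | inj₂ p≡q = p≡q

coprime∧∣⇒*∣ : ∀ {m n o} → Coprime m n → m ∣ o → n ∣ o → m * n ∣ o
coprime∧∣⇒*∣ {m} {n} c m∣o (divides-refl k)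
  rewrite *-comm k n = subst (m * n ∣_) (*-comm k n)
    (*-monoˡ-∣ n (coprime-divisor c m∣o))

-- Counting

𝟙 : {A : Set} → Dec A → ℕ
𝟙 a? = if does a? then 1 else 0

-- The range 1, ..., n is that of `φ`; the recursion on `n` allows shifting and cutting the range by
-- induction.
count : {P : Pred ℕ 0ℓ} → Decidable P → ℕ → ℕ
count P? zero    = 0
count P? (suc n) = 𝟙 (P? (suc n)) + count P? n

count-filter : {P : Pred ℕ 0ℓ} (P? : Decidable P) → ∀ n →
               length (filter P? (applyUpTo suc n)) ≡ count P? n
count-filter P? zero    = refl
count-filter P? (suc n) = begin
  length (filter P? (applyUpTo suc (suc n)))                 ≡⟨ cong (length ∘ filter P?) (applyUpTo-∷ʳ suc n) ⟨
  length (filter P? (applyUpTo suc n ∷ʳ suc n))              ≡⟨ cong length (filter-++ P? (applyUpTo suc n) _) ⟩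
  length (filter P? (applyUpTo suc n) ++ filter P? (suc n ∷ []))  ≡⟨ length-++ (filter P? (applyUpTo suc n)) ⟩
  length (filter P? (applyUpTo suc n)) + length (filter P? (suc n ∷ []))  ≡⟨ cong₂ _+_ (count-filter P? n) last ⟩
  count P? n + 𝟙 (P? (suc n))                                ≡⟨ +-comm (count P? n) _ ⟩
  𝟙 (P? (suc n)) + count P? n                                ∎
  where
  open ≡-Reasoning
  last : length (filter P? (suc n ∷ [])) ≡ 𝟙 (P? (suc n))
  last with P? (suc n)
  ... | yes _ = refl
  ... | no  _ = refl

module _ {P Q : Pred ℕ 0ℓ} (P? : Decidable P) (Q? : Decidable Q) where

  count-cong : ∀ n → (∀ k → P k ⇔ Q k) → count P? n ≡ count Q? n
  count-cong zero    P⇔Q = refl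
  count-cong (suc n) P⇔Q with P? (suc n) | Q? (suc n)
  ... | yes _ | yes _ = cong suc (count-cong n P⇔Q)
  ... | no  _ | no  _ = count-cong n P⇔Q
  ... | yes p | no ¬q = contradiction (Equivalence.to (P⇔Q (suc n)) p) ¬q
  ... | no ¬p | yes q = contradiction (Equivalence.from (P⇔Q (suc n)) q) ¬p

  count-split : ∀ n → count P? n ≡
    count (λ k → P? k ×-dec Q? k) n + count (λ k → P? k ×-dec ¬? (Q? k)) n
  count-split zero    = refl
  count-split (suc n) with P? (suc n) | Q? (suc n)
  ... | yes _ | yes _ = cong suc (count-split n)
  ... | yes _ | no  _ = trans (cong suc (count-split n)) (sym (+-suc _ _))
  ... | no  _ | yes _ = count-split n
  ... | no  _ | no  _ = count-split n

count-none : {P : Pred ℕ 0ℓ} (P? : Decidable P) → ∀ n → (∀ {k} → k ≤ n → .{{NonZero k}} → ¬ P k) → count P? n ≡ 0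
count-none P? zero    none = refl
count-none P? (suc n) none with P? (suc n)
... | yes p = contradiction p (none ≤-refl)
... | no  _ = count-none P? n (λ k≤n → none (m≤n⇒m≤1+n k≤n))

module _ {P : Pred ℕ 0ℓ} (P? : Decidable P) where

  count-+ : ∀ m n → count P? (m + n) ≡ count (λ k → P? (k + n)) m + count P? n
  count-+ zero    n = refl
  count-+ (suc m) n = trans (cong (𝟙 (P? (suc m + n)) +_) (count-+ m n))
                            (sym (+-assoc (𝟙 (P? (suc m + n))) _ _))

  count-periodic : ∀ m → (∀ k j → P (k + j * m) ⇔ P k) →
                   ∀ j → count P? (j * m) ≡ j * count P? m
  count-periodic m per zero    = refl
  count-periodic m per (suc j) = trans (count-+ m (j * m))
    (cong₂ _+_ (count-cong _ P? m (λ k → per k j)) (count-periodic m per j))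

  -- In each block of `p` consecutive numbers only the topmost is a multiple of `p`, so the `o` = p
  -- - 1 others contribute nothing.
  count-multiples : ∀ p .{{_ : NonZero p}} → (∀ {k} → P k → p ∣ k) →
                    ∀ m → count P? (m * p) ≡ count (λ k → P? (k * p)) m
  count-multiples p         P⇒∣ zero    = refl
  count-multiples p@(suc o) P⇒∣ (suc m) = begin
    count P? (p + m * p)                                                      ≡⟨ count-+ p (m * p) ⟩
    𝟙 (P? (suc m * p)) + count (λ k → P? (k + m * p)) o + count P? (m * p)    ≡⟨ cong₂ (λ x y → 𝟙 (P? (suc m * p)) + x + y) block (count-multiples p P⇒∣ m) ⟩
    𝟙 (P? (suc m * p)) + 0 + count (λ k → P? (k * p)) m                       ≡⟨ cong (_+ count (λ k → P? (k * p)) m) (+-identityʳ (𝟙 (P? (suc m * p)))) ⟩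
    𝟙 (P? (suc m * p)) + count (λ k → P? (k * p)) m                           ∎
    where
    open ≡-Reasoning
    block : count (λ k → P? (k + m * p)) o ≡ 0
    block = count-none (λ k → P? (k + m * p)) o λ {k} k≤o Pk →
      >⇒∤ (s≤s k≤o) (∣m+n∣m⇒∣n (subst (p ∣_) (+-comm k (m * p)) (P⇒∣ Pk)) (n∣m*n m))

-- Euler's function

φ≡count : ∀ m → φ m ≡ count (λ k → coprime? k m) m
φ≡count m = count-filter (λ k → coprime? k m) m

coprime-periodic : ∀ m k j → Coprime (k + j * m) m ⇔ Coprime k m
coprime-periodic m k j = mk⇔ to from
  where
  to : Coprime (k + j * m) m → Coprime k m
  to c (i∣k , i∣m) = c (∣m∣n⇒∣m+n i∣k (∣n⇒∣m*n j i∣m) , i∣m)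
  from : Coprime k m → Coprime (k + j * m) m
  from c {i} (i∣k+jm , i∣m) = c (∣m+n∣m⇒∣n (subst (i ∣_) (+-comm k _) i∣k+jm) (∣n⇒∣m*n j i∣m) , i∣m)

count-coprime : ∀ m j → count (λ k → coprime? k m) (j * m) ≡ j * φ m
count-coprime m j = trans (count-periodic (λ k → coprime? k m) m (coprime-periodic m) j)
                          (cong (j *_) (sym (φ≡count m)))

-- Coprimality to `k * m` and to `m` are the same condition here, and the range up to `k * m`
-- consists of `k` periods of it.
φ-*-primesDividing : ∀ k m → (∀ {p} → Prime p → p ∣ k → p ∣ m) → φ (k * m) ≡ k * φ m
φ-*-primesDividing k m k⊑m = begin
  φ (k * m)                                      ≡⟨ φ≡count (k * m) ⟩
  count (λ x → coprime? x (k * m)) (k * m)       ≡⟨ count-cong _ _ (k * m) (λ x → mk⇔ (coprime-∣ʳ (n∣m*n k)) (extend x)) ⟩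
  count (λ x → coprime? x m) (k * m)             ≡⟨ count-coprime m k ⟩
  k * φ m                                        ∎
  where
  open ≡-Reasoning
  extend : ∀ x → Coprime x m → Coprime x (k * m)
  extend x c = coprime-*ʳ (coprimeByPrimes λ p-prime p∣x p∣k → coprime⇒∤ c p-prime p∣x (k⊑m p-prime p∣k)) c

-- The residues coprime to m but not to p * m are the multiples of p, which
-- correspond to the residues modulo m coprime to m.
φ-prime-* : ∀ {p m} → Prime p → p ∤ m → φ (p * m) ≡ pred p * φ m
φ-prime-* {p@(suc o)} {m} p-prime p∤m = +-cancelˡ-≡ (φ m) _ _ (begin
  φ m + φ (p * m)                                           ≡⟨ cong₂ _+_ multiples others ⟨
  count (λ k → coprime? k m ×-dec p ∣? k) (p * m)
    + count (λ k → coprime? k m ×-dec ¬? (p ∣? k)) (p * m)  ≡⟨ count-split (λ k → coprime? k m) (p ∣?_) (p * m) ⟨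
  count (λ k → coprime? k m) (p * m)                        ≡⟨ count-coprime m p ⟩
  p * φ m                                                   ∎)
  where
  open ≡-Reasoning

  p⊥m : Coprime p m
  p⊥m = prime∤⇒coprime p-prime p∤m

  unscale : ∀ k → (Coprime (k * p) m × p ∣ k * p) ⇔ Coprime k m
  unscale k = mk⇔ to from
    where
    to : Coprime (k * p) m × p ∣ k * p → Coprime k m
    to (c , _) = coprime-∣ˡ (m∣m*n p) c
    from : Coprime k m → Coprime (k * p) m × p ∣ k * p
    from c = coprime-*ˡ c p⊥m , n∣m*n k

  split : ∀ k → (Coprime k m × p ∤ k) ⇔ Coprime k (p * m)
  split k = mk⇔ to from
    where
    to : Coprime k m × p ∤ k → Coprime k (p * m)
    to (c , p∤k) = coprime-*ʳ (Coprime.sym (prime∤⇒coprime p-prime p∤k)) c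
    from : Coprime k (p * m) → Coprime k m × p ∤ k
    from c = coprime-∣ʳ (n∣m*n p) c , λ p∣k → coprime⇒∤ c p-prime p∣k (m∣m*n m)

  multiples : count (λ k → coprime? k m ×-dec p ∣? k) (p * m) ≡ φ m
  multiples = begin
    count (λ k → coprime? k m ×-dec p ∣? k) (p * m)              ≡⟨ cong (count _) (*-comm p m) ⟩
    count (λ k → coprime? k m ×-dec p ∣? k) (m * p)              ≡⟨ count-multiples _ p proj₂ m ⟩
    count (λ k → coprime? (k * p) m ×-dec p ∣? (k * p)) m        ≡⟨ count-cong _ _ m unscale ⟩
    count (λ k → coprime? k m) m                                 ≡⟨ φ≡count m ⟨
    φ m                                                          ∎

  others : count (λ k → coprime? k m ×-dec ¬? (p ∣? k)) (p * m) ≡ φ (p * m)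
  others = trans
    (count-cong _ _ (p * m) split)
    (sym (φ≡count (p * m)))

unique⇒∤product : ∀ {p ps} → Prime p → All (p ≢_) ps → All Prime ps → p ∤ product ps
unique⇒∤product p-prime p∉ primes p∣ = All.lookup p∉ (factorisationHasAllPrimeFactors p-prime p∣ primes) refl

φ-product : ∀ {ps} → Unique ps → All Prime ps → φ (product ps) ≡ product (map pred ps)
φ-product []             []                = refl
φ-product {p ∷ _} (p∉ ∷ unique) (p-prime ∷ primes) = trans
  (φ-prime-* p-prime (unique⇒∤product p-prime p∉ primes))
  (cong (pred p *_) (φ-product unique primes))

product∣ : ∀ {ps x} → Unique ps → All Prime ps → All (_∣ x) ps → product ps ∣ x
product∣ []            []                 []            = 1∣ _
product∣ (p∉ ∷ unique) (p-prime ∷ primes) (p∣x ∷ ps∣x) = coprime∧∣⇒*∣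
  (prime∤⇒coprime p-prime (unique⇒∤product p-prime p∉ primes)) p∣x (product∣ unique primes ps∣x)

-- The radical

primeFactor? : ∀ m p → Dec (Prime p × p ∣ m)
primeFactor? m p = prime? p ×-dec p ∣? m

primeFactors : ℕ → List ℕ
primeFactors m = filter (primeFactor? m) (upTo (suc m))

primeFactors-prime : ∀ m → All Prime (primeFactors m)
primeFactors-prime m = All.map proj₁ (all-filter (primeFactor? m) (upTo (suc m)))

primeFactors-unique : ∀ m → Unique (primeFactors m)
primeFactors-unique m = filter⁺ (primeFactor? m) (upTo⁺ (suc m))

∈-primeFactors⁺ : ∀ {m p} .{{_ : NonZero m}} → Prime p → p ∣ m → p ∈ primeFactors m
∈-primeFactors⁺ {m} p-prime p∣m = ∈-filter⁺ (primeFactor? m) (∈-upTo⁺ (s≤s (∣⇒≤ p∣m))) (p-prime , p∣m)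

∈-primeFactors⁻ : ∀ m {p} → p ∈ primeFactors m → Prime p × p ∣ m
∈-primeFactors⁻ m p∈ = proj₂ (∈-filter⁻ (primeFactor? m) {xs = upTo (suc m)} p∈)

prime∣⇒∣rad : ∀ {m p} .{{_ : NonZero m}} → Prime p → p ∣ m → p ∣ rad m
prime∣⇒∣rad p-prime p∣m = ∈⇒∣product (∈-primeFactors⁺ p-prime p∣m)

rad∣ : ∀ m {x} → (∀ {p} → Prime p → p ∣ m → p ∣ x) → rad m ∣ x
rad∣ m m⊑x = product∣ (primeFactors-unique m) (primeFactors-prime m)
  (All.map (λ (p-prime , p∣m) → m⊑x p-prime p∣m) (all-filter (primeFactor? m) (upTo (suc m))))

rad-nonZero : ∀ m → NonZero (rad m)
rad-nonZero m = productOfPrimes≢0 (primeFactors-prime m)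

φ-rad : ∀ m → φ (rad m) ≡ product (map pred (primeFactors m))
φ-rad m = φ-product (primeFactors-unique m) (primeFactors-prime m)

φ-*-rad : ∀ {m k} .{{_ : NonZero m}} → m ≡ k * rad m → φ m ≡ k * φ (rad m)
φ-*-rad {m} {k} eq = trans (cong φ eq)
  (φ-*-primesDividing k (rad m) λ p-prime p∣k → prime∣⇒∣rad p-prime
    (subst (_ ∣_) (sym eq) (∣m⇒∣m*n (rad m) p∣k)))

-- Powers of 1 + w

infix 4 _≡1[mod_]

-- Naming the difference `w` lets the expansions of (1 + w)^n apply directly. It also rules out x =
-- 0, which `%` would admit modulo 1.
_≡1[mod_] : ℕ → ℕ → Set
x ≡1[mod m ] = ∃[ w ] x ≡ 1 + w × m ∣ w

≡1-* : ∀ {m x y} → x ≡1[mod m ] → y ≡1[mod m ] → x * y ≡1[mod m ]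
≡1-* (v , refl , m∣v) (w , refl , m∣w) = w + v * (1 + w) , refl , ∣m∣n⇒∣m+n m∣w (∣m⇒∣m*n (1 + w) m∣v)

≡1-^ : ∀ {m x} n → x ≡1[mod m ] → x ^ n ≡1[mod m ]
≡1-^ {m} zero    x≡1 = 0 , refl , m ∣0
≡1-^     (suc n) x≡1 = ≡1-* x≡1 (≡1-^ n x≡1)

≡1-∣ : ∀ {l m x} → l ∣ m → x ≡1[mod m ] → x ≡1[mod l ]
≡1-∣ l∣m (w , eq , m∣w) = w , eq , ∣-trans l∣m m∣w

≡1-coprime : ∀ {l m x} → Coprime l m → x ≡1[mod l ] → x ≡1[mod m ] → x ≡1[mod l * m ]
≡1-coprime c (w , refl , l∣w) (w , refl , m∣w) = w , refl , coprime∧∣⇒*∣ c l∣w m∣w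

%≡1⇒≡1 : ∀ {m x} .{{_ : NonZero m}} → 0 < x → x % m ≡ 1 % m → x ≡1[mod m ]
%≡1⇒≡1 {m} {suc w} _ eq = w , refl , ∣m+n∣m⇒∣n
  (subst (m ∣_) (sym lemma) (n∣m*n (suc w / m))) (n∣m*n (1 / m))
  where
  open ≡-Reasoning
  lemma : 1 / m * m + w ≡ suc w / m * m
  lemma = +-cancelˡ-≡ (1 % m) _ _ (begin
    1 % m + (1 / m * m + w)      ≡⟨ +-assoc (1 % m) _ w ⟨
    1 % m + 1 / m * m + w        ≡⟨ cong (_+ w) (m≡m%n+[m/n]*n 1 m) ⟨
    suc w                        ≡⟨ m≡m%n+[m/n]*n (suc w) m ⟩
    suc w % m + suc w / m * m    ≡⟨ cong (_+ suc w / m * m) eq ⟩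
    1 % m + suc w / m * m        ∎)

≡1⇒%≡1 : ∀ {m x} .{{_ : NonZero m}} → x ≡1[mod m ] → x % m ≡ 1 % m
≡1⇒%≡1 (w , refl , m∣w) = %-remove-+ʳ 1 m∣w

expansion₂ : ∀ w n → ∃[ t ] (1 + w) ^ n ≡ 1 + w * (n + w * t)
expansion₂ w zero    = 0 , solve 1 (λ w → con 1 := con 1 :+ w :* (w :* con 0)) refl w
expansion₂ w (suc n) with t , eq ← expansion₂ w n = t + n + w * t , trans (cong ((1 + w) *_) eq)
  (solve 3 (λ w n t → (con 1 :+ w) :* (con 1 :+ w :* (n :+ w :* t))
    := con 1 :+ w :* (con 1 :+ n :+ w :* (t :+ n :+ w :* t))) refl w n t)

-- Here t = n (n - 1) / 2.
expansion₃ : ∀ w n → ∃[ t ] ∃[ u ]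
  t + t + n ≡ n * n × (1 + w) ^ n ≡ 1 + w * (n + w * t + w * w * u)
expansion₃ w zero    = 0 , 0 , refl , solve 1 (λ w → con 1 := con 1 :+ w :* (con 0 :+ w :* con 0 :+ w :* w :* con 0)) refl w
expansion₃ w (suc n) with t , u , t≡ , eq ← expansion₃ w n =
  t + n , u + t + w * u ,
  trans (solve 2 (λ t n → t :+ n :+ (t :+ n) :+ (con 1 :+ n) := t :+ t :+ n :+ (n :+ (con 1 :+ n))) refl t n)
    (trans (cong (_+ (n + (1 + n))) t≡)
      (solve 1 (λ n → n :* n :+ (n :+ (con 1 :+ n)) := (con 1 :+ n) :* (con 1 :+ n)) refl n)) ,
  trans (cong ((1 + w) *_) eq)
    (solve 4 (λ w n t u → (con 1 :+ w) :* (con 1 :+ w :* (n :+ w :* t :+ w :* w :* u))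
      := con 1 :+ w :* (con 1 :+ n :+ w :* (t :+ n) :+ w :* w :* (u :+ t :+ w :* u))) refl w n t u)

odd-prime : ∀ {p} → 2 ∤ p → ∃[ h ] p ≡ 1 + h * 2
odd-prime {p} 2∤p with p % 2 | m≡m%n+[m/n]*n p 2 | m%n<n p 2
... | 0           | eq | _ = contradiction (divides (p / 2) eq) 2∤p
... | 1           | eq | _ = p / 2 , eq
... | suc (suc _) | _  | s≤s (s≤s ())

-- For odd `p` the coefficient p(p-1)/2 of w² is a multiple of `p`, and the cubic remainder gains
-- its factor `p` from p ∣ w. So p w can be taken out of (1 + w)^p - 1, leaving a number that is 1
-- modulo w.
odd-power : ∀ {p w} → 2 ∤ p → p ∣ w → ∃[ j ] (1 + w) ^ p ≡ 1 + p * (w * (1 + w * j))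
odd-power {p} 2∤p (divides-refl v) with odd-prime 2∤p
... | h , refl with expansion₃ (v * (1 + h * 2)) (1 + h * 2)
...   | t , u , t≡ , eq = h + v * u , trans eq (cong suc (begin
    w * (p + w * t + w * w * u)                ≡⟨ cong (λ x → w * (p + w * x + w * w * u)) t≡p*h ⟩
    w * (p + w * (p * h) + w * w * u)          ≡⟨ solve 4 (λ p v h u → (v :* p) :* (p :+ (v :* p) :* (p :* h) :+ (v :* p) :* (v :* p) :* u)
                                                    := p :* ((v :* p) :* (con 1 :+ (v :* p) :* (h :+ v :* u)))) refl p v h u ⟩
    p * (w * (1 + w * (h + v * u)))            ∎))
  where
  open ≡-Reasoning
  w = v * p
  t≡p*h : t ≡ p * h
  t≡p*h = *-cancelʳ-≡ t (p * h) 2 (+-cancelʳ-≡ p _ _ (begin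
    t * 2 + p        ≡⟨ solve 2 (λ t p → t :* con 2 :+ p := t :+ t :+ p) refl t p ⟩
    t + t + p        ≡⟨ t≡ ⟩
    p * p            ≡⟨ solve 1 (λ h → (con 1 :+ h :* con 2) :* (con 1 :+ h :* con 2) := (con 1 :+ h :* con 2) :* h :* con 2 :+ (con 1 :+ h :* con 2)) refl h ⟩
    p * h * 2 + p    ∎))

-- With n = p n′ and (1 + y)^n′ = 1 + w, the quotient of (1 + w)^p - 1 by p w
-- is 1 modulo w, hence coprime to y: each prime of the modulus can be traded
-- for a factor of the exponent.
1+y-exponent : ∀ {ps y n} .{{_ : NonZero y}} → All (λ p → Prime p × 2 ∤ p × p ∣ y) ps →
               (1 + y) ^ n ≡1[mod y * product ps ] → product ps ∣ n
1+y-exponent [] _ = 1∣ _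
1+y-exponent {p ∷ ps} {y} {n} ((p-prime , 2∤p , p∣y) ∷ odd) (w , eq , ypP∣w) = done p∣n
  where
  P = product ps
  instance _ = prime⇒nonZero p-prime

  -- Cancelling `y` from y p P ∣ y (n + y t) leaves p ∣ n + y t, and `p` divides `y`.
  p∣n : p ∣ n
  p∣n with t , eq′ ← expansion₂ y n = ∣m+n∣m⇒∣n (subst (p ∣_) (+-comm n _)
    (∣-trans (m∣m*n P) (*-cancelˡ-∣ y (subst (y * (p * P) ∣_) (suc-injective (trans (sym eq) eq′)) ypP∣w))))
    (∣m⇒∣m*n t p∣y)

  done : p ∣ n → p * P ∣ n
  done (divides-refl n′) with expansion₂ y n′
  ... | t , eq′ with odd-power {w = y * (n′ + y * t)} 2∤p (∣m⇒∣m*n _ p∣y)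
  ...   | j , eq″ = subst (p * P ∣_) (*-comm p n′) (*-monoʳ-∣ p (1+y-exponent odd (w′ , eq′ , yP∣w′)))
    where
    w′ = y * (n′ + y * t)

    w≡ : w ≡ p * (w′ * (1 + w′ * j))
    w≡ = suc-injective (begin
      1 + w                          ≡⟨ eq ⟨
      (1 + y) ^ (n′ * p)             ≡⟨ ^-*-assoc (1 + y) n′ p ⟨
      ((1 + y) ^ n′) ^ p             ≡⟨ cong (_^ p) eq′ ⟩
      (1 + w′) ^ p                   ≡⟨ eq″ ⟩
      1 + p * (w′ * (1 + w′ * j))    ∎)
      where open ≡-Reasoning

    y∣w′j : y ∣ w′ * j
    y∣w′j = ∣m⇒∣m*n j (m∣m*n (n′ + y * t))

    unit : ∀ {x} → x ∣ y → Coprime x (1 + w′ * j)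
    unit x∣y = ∣⇒coprime-1+ (∣-trans x∣y y∣w′j)

    units : ∀ {qs} → All (λ q → Prime q × 2 ∤ q × q ∣ y) qs → Coprime (product qs) (1 + w′ * j)
    units []                    = Coprime.1-coprimeTo _
    units ((_ , _ , q∣y) ∷ qs) = coprime-*ˡ (unit q∣y) (units qs)

    yP∣ : y * P ∣ w′ * (1 + w′ * j)
    yP∣ = *-cancelˡ-∣ p (subst₂ _∣_ (solve 3 (λ y p P → y :* (p :* P) := p :* (y :* P)) refl y p P) w≡ ypP∣w)

    yP∣w′ : y * P ∣ w′
    yP∣w′ = coprime-divisor (coprime-*ˡ (unit ∣-refl) (units odd)) (subst (y * P ∣_) (*-comm w′ _) yP∣)

-- The Carmichael function

^-cong-% : ∀ {m x y} .{{_ : NonZero m}} n → x % m ≡ y % m → (x ^ n) % m ≡ (y ^ n) % m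
^-cong-% {m} {x} {y} zero    eq = refl
^-cong-% {m} {x} {y} (suc n) eq = begin
  (x * x ^ n) % m                  ≡⟨ %-distribˡ-* x (x ^ n) m ⟩
  ((x % m) * ((x ^ n) % m)) % m    ≡⟨ cong₂ (λ u v → (u * v) % m) eq (^-cong-% n eq) ⟩
  ((y % m) * ((y ^ n) % m)) % m    ≡⟨ %-distribˡ-* y (y ^ n) m ⟨
  (y * y ^ n) % m                  ∎
  where open ≡-Reasoning

≡1-cancelʳ : ∀ {m x y} .{{_ : NonZero m}} → 0 < x → y ≡1[mod m ] → x * y ≡1[mod m ] → x ≡1[mod m ]
≡1-cancelʳ {m} {x} 0<x (w , refl , m∣w) xy≡1 = %≡1⇒≡1 0<x (begin
  x % m              ≡⟨ %-remove-+ʳ x (∣n⇒∣m*n x m∣w) ⟨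
  (x + x * w) % m    ≡⟨ cong (_% m) (*-suc x w) ⟨
  (x * suc w) % m    ≡⟨ ≡1⇒%≡1 xy≡1 ⟩
  1 % m              ∎)
  where open ≡-Reasoning

≡1-% : ∀ {m a l} .{{_ : NonZero m}} .{{_ : NonZero l}} .{{_ : NonZero a}} e →
       a ^ l ≡1[mod m ] → a ^ e ≡1[mod m ] → a ^ (e % l) ≡1[mod m ]
≡1-% {m} {a} {l} e a^l≡1 a^e≡1 = ≡1-cancelʳ (m^n>0 a (e % l)) (≡1-^ (e / l) a^l≡1)
  (subst (_≡1[mod m ]) (begin
    a ^ e                              ≡⟨ cong (a ^_) (m≡m%n+[m/n]*n e l) ⟩
    a ^ (e % l + e / l * l)            ≡⟨ ^-distribˡ-+-* a (e % l) (e / l * l) ⟩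
    a ^ (e % l) * a ^ (e / l * l)      ≡⟨ cong (λ x → a ^ (e % l) * a ^ x) (*-comm (e / l) l) ⟩
    a ^ (e % l) * a ^ (l * (e / l))    ≡⟨ cong (a ^ (e % l) *_) (^-*-assoc a l (e / l)) ⟨
    a ^ (e % l) * (a ^ l) ^ (e / l)    ∎) a^e≡1)
  where open ≡-Reasoning

0<carmichael : ∀ m .{{_ : NonZero m}} → 0 < carmichael m
0<carmichael m = proj₁ (proj₂ (exponent m))

^carmichael≡1 : ∀ {m a} .{{_ : NonZero m}} .{{_ : NonZero a}} → Coprime a m →
                a ^ carmichael m ≡1[mod m ]
^carmichael≡1 {m} {a} c = %≡1⇒≡1 (m^n>0 a (carmichael m)) (begin
  (a ^ carmichael m) % m          ≡⟨ ^-cong-% (carmichael m) (m%n%n≡m%n a m) ⟨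
  ((a % m) ^ carmichael m) % m    ≡⟨ proj₁ (proj₂ (proj₂ (exponent m))) (m%n<n a m)
                                       (λ (i∣a%m , i∣m) → c (∣n∣m%n⇒∣m i∣m i∣a%m , i∣m)) ⟩
  1 % m                           ∎)
  where open ≡-Reasoning

-- The remainder of `e` modulo λ(m) annihilates every unit as well, and it is below λ(m); minimality
-- leaves only 0.
carmichael∣ : ∀ {m e} .{{_ : NonZero m}} →
              (∀ {a} .{{_ : NonZero a}} → Coprime a m → a ^ e ≡1[mod m ]) → carmichael m ∣ e
carmichael∣ {m} {e} annihilates = m%n≡0⇒n∣m e l (remainder≡0 (e % l) refl)
  where
  l = carmichael m
  instance _ = >-nonZero (0<carmichael m)

  remainder-annihilates : Annihilates m (e % l)
  -- The residue 0 is a unit only for m = 1, where all residues agree.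
  remainder-annihilates {zero} _ c with refl ← Coprime.0-coprimeTo-m⇒m≡1 c =
    trans (n%1≡0 (0 ^ (e % l))) refl
  remainder-annihilates {suc _} _ c = ≡1⇒%≡1 (≡1-% {l = l} e (^carmichael≡1 c) (annihilates c))

  remainder≡0 : ∀ s → e % l ≡ s → e % l ≡ 0
  remainder≡0 zero    eq = eq
  remainder≡0 (suc s) eq = contradiction
    (proj₂ (proj₂ (proj₂ (exponent m))) (subst (0 <_) (sym eq) z<s) remainder-annihilates)
    (<⇒≱ (m%n<n e l))

-- The unit m - 1 has square 1 + m(m - 2). An odd λ(m) would therefore make m - 1 itself 1 modulo m,
-- that is m ∣ m - 2, impossible for m > 2.
2∣carmichael : ∀ {m} .{{_ : NonZero m}} → 2 < m → 2 ∣ carmichael m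
2∣carmichael {1} (s≤s ())
2∣carmichael {2} (s≤s (s≤s ()))
2∣carmichael {m@(suc (suc (suc k)))} _ with 2 ∣? carmichael m
... | yes 2∣λ = 2∣λ
... | no  2∤λ with h , eq ← odd-prime 2∤λ = contradiction −1≡1 λ where
        (w , refl , m∣w) → >⇒∤ (n≤1+n _) m∣w
  where
  −1 = 2 + k
  −1-coprime : Coprime −1 m
  −1-coprime = ∣⇒coprime-1+ ∣-refl
  square : −1 ^ 2 ≡1[mod m ]
  square = m * (1 + k) , solve 1 (λ k → (con 2 :+ k) :* ((con 2 :+ k) :* con 1) := con 1 :+ (con 3 :+ k) :* (con 1 :+ k)) refl k , m∣m*n (1 + k)
  −1≡1 : −1 ≡1[mod m ]
  −1≡1 = ≡1-cancelʳ z<s (≡1-^ h square) (subst (_≡1[mod m ])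
    (trans (cong (−1 ^_) (trans eq (cong suc (*-comm h 2)))) (cong (−1 *_) (sym (^-*-assoc −1 2 h))))
    (^carmichael≡1 −1-coprime))

-- 1 + rad m is a unit modulo m.
cofactor∣carmichael : ∀ {m c} .{{_ : NonZero m}} → 2 ∤ c → rad m * c ∣ m → c ∣ carmichael m
cofactor∣carmichael {m} {zero}  2∤c _   = contradiction (2 ∣0) 2∤c
cofactor∣carmichael {m} {c@(suc _)} 2∤c rc∣m with factorise c
... | record { factors = ps ; isFactorisation = eq ; factorsPrime = primes } =
  subst (_∣ carmichael m) (sym eq) (1+y-exponent {{rad-nonZero m}} (All.tabulate good)
    (≡1-∣ (subst (λ x → rad m * x ∣ m) eq rc∣m) (^carmichael≡1 unit)))
  where
  unit : Coprime (1 + rad m) m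
  unit = coprimeByPrimes λ p-prime p∣1+r p∣m → coprime⇒∤ (∣⇒coprime-1+ ∣-refl) p-prime (prime∣⇒∣rad p-prime p∣m) p∣1+r

  good : ∀ {p} → p ∈ ps → Prime p × 2 ∤ p × p ∣ rad m
  good {p} p∈ps = p-prime , (λ 2∣p → 2∤c (∣-trans 2∣p p∣c)) ,
    prime∣⇒∣rad p-prime (∣-trans p∣c (∣-trans (n∣m*n (rad m)) rc∣m))
    where
    p-prime = All.lookup primes p∈ps
    p∣c : p ∣ c
    p∣c = subst (p ∣_) (sym eq) (∈⇒∣product p∈ps)

-- Fermat's little theorem

prime∤! : ∀ {p k} → Prime p → k < p → p ∤ k !
prime∤! {k = zero}  p-prime _   p∣1 = prime⇒≢1 p-prime (∣1⇒≡1 p∣1)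
prime∤! {k = suc k} p-prime k<p p∣k! with euclidsLemma (suc k) (k !) p-prime p∣k!
... | inj₁ p∣1+k = >⇒∤ k<p p∣1+k
... | inj₂ p∣k!′ = prime∤! p-prime (<⇒≤ k<p) p∣k!′

C*k!*[n∸k]! : ∀ {n k} → k ≤ n → (n choose k) * (k ! * (n ∸ k) !) ≡ n !
C*k!*[n∸k]! {n} {k} k≤n = trans (cong (_* (k ! * (n ∸ k) !)) (nCk≡n!/k![n-k]! k≤n)) (m/n*n≡m (k![n∸k]!∣n! k≤n))
  where instance _ = k !* (n ∸ k) !≢0

prime∣C : ∀ {p k} → Prime p → 0 < k → k < p → p ∣ p choose k
prime∣C {p@(suc o)} {k} p-prime 0<k k<p with euclidsLemma (p choose k) (k ! * (p ∸ k) !) p-prime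
  (subst (p ∣_) (sym (C*k!*[n∸k]! (<⇒≤ k<p))) (m∣m*n (o !)))
... | inj₁ p∣C = p∣C
... | inj₂ p∣k!*[p∸k]! with euclidsLemma (k !) ((p ∸ k) !) p-prime p∣k!*[p∸k]!
...   | inj₁ p∣ = contradiction p∣ (prime∤! p-prime k<p)
...   | inj₂ p∣ = contradiction p∣ (prime∤! p-prime (∸-monoʳ-< 0<k (<⇒≤ k<p)))

-- The cut-off is separate from the exponent, so that Pascal's rule works on partial sums and the
-- last term of (1 + a)^p can be split off.
binomialSum : ℕ → ℕ → ℕ → ℕ
binomialSum n a zero    = 0
binomialSum n a (suc k) = binomialSum n a k + (n choose k) * a ^ k

-- Pascal's rule summed over the terms; the factor `a` shifts the second sum by one, so it stops one
-- term earlier.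
binomialSum-suc : ∀ n a k → binomialSum (suc n) a (suc k) ≡ binomialSum n a (suc k) + a * binomialSum n a k
binomialSum-suc n a zero    = cong₂ _+_ {x = 1} refl (sym (*-zeroʳ a))
binomialSum-suc n a (suc k) = begin
  S′ + (suc n choose suc k) * a ^ suc k                              ≡⟨ cong₂ (λ x y → x + y * a ^ suc k) (binomialSum-suc n a k) (sym (nCk+nC[k+1]≡[n+1]C[k+1] n k)) ⟩
  S + (n choose k) * a ^ k + a * S + (n choose k + n choose suc k) * a ^ suc k ≡⟨ solve 5 (λ S a u v x → S :+ u :* x :+ a :* S :+ (u :+ v) :* (a :* x)
                                                                   := S :+ u :* x :+ v :* (a :* x) :+ a :* (S :+ u :* x)) refl S a (n choose k) (n choose suc k) (a ^ k) ⟩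
  S + (n choose k) * a ^ k + (n choose suc k) * a ^ suc k + a * (S + (n choose k) * a ^ k) ∎
  where
  open ≡-Reasoning
  S = binomialSum n a k
  S′ = binomialSum (suc n) a (suc k)

binomial : ∀ n a → binomialSum n a (suc n) ≡ (1 + a) ^ n
binomial zero    a = refl
binomial (suc n) a = begin
  binomialSum (suc n) a (2 + n)                               ≡⟨ binomialSum-suc n a (suc n) ⟩
  S + (n choose suc n) * a ^ suc n + a * S                           ≡⟨ cong (λ x → S + x * a ^ suc n + a * S) (k>n⇒nCk≡0 (n<1+n n)) ⟩
  S + 0 + a * S                                               ≡⟨ cong (_+ a * S) (+-identityʳ S) ⟩
  (1 + a) * S                                                 ≡⟨ cong ((1 + a) *_) (binomial n a) ⟩
  (1 + a) ^ suc n                                             ∎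
  where
  open ≡-Reasoning
  S = binomialSum n a (suc n)

binomialSum-prime : ∀ {p} a → Prime p → ∀ k → k < p → binomialSum p a (suc k) ≡1[mod p ]
binomialSum-prime {p} a p-prime zero    _   = 0 , refl , p ∣0
binomialSum-prime {p} a p-prime (suc k) k<p with w , eq , p∣w ← binomialSum-prime a p-prime k (<⇒≤ k<p) =
  w + (p choose suc k) * a ^ suc k , cong (_+ (p choose suc k) * a ^ suc k) eq ,
  ∣m∣n⇒∣m+n p∣w (∣m⇒∣m*n (a ^ suc k) (prime∣C p-prime z<s k<p))

freshman : ∀ {p} a → Prime p → ∃[ w ] (1 + a) ^ p ≡ 1 + w + a ^ p × p ∣ w
freshman {p@(suc o)} a p-prime with w , eq , p∣w ← binomialSum-prime a p-prime o ≤-refl = w ,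
  trans (sym (binomial p a)) (cong₂ _+_ eq (trans (cong (_* a ^ p) (nCn≡1 p)) (*-identityˡ _))) , p∣w

fermat : ∀ {p} → Prime p → ∀ a → ∃[ w ] a ^ p ≡ a + w × p ∣ w
fermat {suc o} p-prime zero    = 0 , refl , suc o ∣0
fermat p-prime (suc a) with w , eq , p∣w ← fermat p-prime a | v , eq′ , p∣v ← freshman a p-prime =
  v + w , trans eq′ (trans (cong (1 + v +_) eq)
    (solve 3 (λ a v w → con 1 :+ v :+ (a :+ w) := con 1 :+ a :+ (v :+ w)) refl a v w)) , ∣m∣n⇒∣m+n p∣v p∣w

fermat-unit : ∀ {p a} .{{_ : NonZero a}} → Prime p → p ∤ a → a ^ pred p ≡1[mod p ]
fermat-unit {p@(suc o)} {a} p-prime p∤a with w , eq , p∣w ← fermat p-prime a | a ^ o | m^n>0 a o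
... | suc v | _ = v , refl , coprime-divisor (prime∤⇒coprime p-prime p∤a) (subst (p ∣_) (sym av≡w) p∣w)
  where
  av≡w : a * v ≡ w
  av≡w = +-cancelˡ-≡ a _ _ (trans (sym (*-suc a v)) eq)

-- In (1 + w)^p = 1 + w (p + w t) both factors after the 1 are multiples of `p`. This lifts Fermat's
-- congruence to p², the part of the modulus of (ii) that is not squarefree.
≡1-^prime : ∀ {p x} → Prime p → x ≡1[mod p ] → x ^ p ≡1[mod p * p ]
≡1-^prime {p} _ (w , refl , p∣w) with t , eq ← expansion₂ w p = w * (p + w * t) , eq ,
  *-pres-∣ p∣w (∣m∣n⇒∣m+n ∣-refl (∣m⇒∣m*n t p∣w))

-- Polynomials with leading coefficient 1 and the listed lower coefficients,
-- constant term first.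

eval : List ℕ → ℕ → ℕ
eval []       x = 1
eval (c ∷ cs) x = c + x * eval cs x

-- Synthetic division: the Horner values at `a` of the tails `cs` of `c ∷ cs` are the coefficients
-- of its quotient by X - a, the leading 1 again being implicit.
quotientAt : List ℕ → ℕ → List ℕ
quotientAt []       a = []
quotientAt (c ∷ cs) a = eval (c ∷ cs) a ∷ quotientAt cs a

length-quotientAt : ∀ cs a → length (quotientAt cs a) ≡ length cs
length-quotientAt []       a = refl
length-quotientAt (c ∷ cs) a = cong suc (length-quotientAt cs a)

-- This is f(a) - f(x) = (a - x) Q(x), with a = x + e to stay within ℕ.
factor : ∀ c cs x e → eval (c ∷ cs) (x + e) ≡ eval (c ∷ cs) x + e * eval (quotientAt cs (x + e)) x
factor c []        x e = solve 3 (λ c x e → c :+ (x :+ e) :* con 1 := c :+ x :* con 1 :+ e :* con 1) refl c x e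
factor c (c′ ∷ cs) x e = begin
  c + (x + e) * E                ≡⟨ solve 4 (λ c x e E → c :+ (x :+ e) :* E := c :+ x :* E :+ e :* E) refl c x e E ⟩
  c + x * E + e * E              ≡⟨ cong (λ y → c + x * y + e * E) (factor c′ cs x e) ⟩
  c + x * (F + e * Q) + e * E    ≡⟨ solve 6 (λ c x e E F Q → c :+ x :* (F :+ e :* Q) :+ e :* E := c :+ x :* F :+ e :* (E :+ x :* Q)) refl c x e E F Q ⟩
  c + x * F + e * (E + x * Q)    ∎
  where
  open ≡-Reasoning
  E = eval (c′ ∷ cs) (x + e)
  F = eval (c′ ∷ cs) x
  Q = eval (quotientAt cs (x + e)) x

-- Lagrange's bound for the consecutive roots 1, ..., n + 1. Dividing by X - a for the largest root
-- `a` keeps the others as roots of the quotient, since each a - x lies strictly between 0 and r.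
¬tooManyRoots : ∀ {r} → Prime r → ∀ n cs → length cs ≡ n → n < r →
                ¬ (∀ {x} → 0 < x → x ≤ 1 + n → r ∣ eval cs x)
¬tooManyRoots r-prime zero    []       _  _   roots = prime⇒≢1 r-prime (∣1⇒≡1 (roots {1} z<s ≤-refl))
¬tooManyRoots {r} r-prime (suc n) (c ∷ cs) eq n<r roots =
  ¬tooManyRoots r-prime n (quotientAt cs a) (trans (length-quotientAt cs a) (suc-injective eq)) (<⇒≤ n<r) roots′
  where
  a = 2 + n
  roots′ : ∀ {x} → 0 < x → x ≤ 1 + n → r ∣ eval (quotientAt cs a) x
  roots′ {x} 0<x x≤1+n = case euclidsLemma (a ∸ x) _ r-prime
    (∣m+n∣m⇒∣n (subst (r ∣_) eval-a (roots z<s ≤-refl)) (roots 0<x (m≤n⇒m≤1+n x≤1+n))) of λ where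
      (inj₂ r∣Q)   → r∣Q
      (inj₁ r∣a∸x) → contradiction r∣a∸x
        (>⇒∤ {{>-nonZero (m<n⇒0<n∸m (s≤s x≤1+n))}} (≤-trans (s≤s (∸-monoʳ-≤ a 0<x)) n<r))
    where
    eval-a : eval (c ∷ cs) a ≡ eval (c ∷ cs) x + (a ∸ x) * eval (quotientAt cs a) x
    eval-a = subst (λ y → eval (c ∷ cs) y ≡ eval (c ∷ cs) x + (a ∸ x) * eval (quotientAt cs y) x)
      (m+[n∸m]≡n (m≤n⇒m≤1+n x≤1+n)) (factor c cs x (a ∸ x))

eval-zeros : ∀ n x → eval (replicate n 0) x ≡ x ^ n
eval-zeros zero    x = refl
eval-zeros (suc n) x = cong (x *_) (eval-zeros n x)

-- Takes the place of a primitive root: if e modulo r - 1 were some d > 0, then X^d - 1 would have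
-- more than d roots modulo r.
pred∣exponent : ∀ {r e} → Prime r → (∀ {a} → 0 < a → a < r → a ^ e ≡1[mod r ]) → pred r ∣ e
pred∣exponent {0} r-prime = contradiction r-prime ¬prime[0]
pred∣exponent {1} r-prime = contradiction r-prime ¬prime[1]
pred∣exponent {r@(suc o@(suc _))} {e} r-prime annihilates = m%n≡0⇒n∣m e o (remainder≡0 (e % o) refl)
  where
  remainder-annihilates : ∀ {a} → 0 < a → a < r → a ^ (e % o) ≡1[mod r ]
  remainder-annihilates 0<a a<r = ≡1-% e (fermat-unit r-prime (>⇒∤ a<r)) (annihilates 0<a a<r)
    where instance _ = >-nonZero 0<a

  remainder≡0 : ∀ s → e % o ≡ s → e % o ≡ 0
  remainder≡0 zero    eq = eq
  remainder≡0 (suc s) eq = contradiction (λ {x} → roots {x})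
    -- The constant term `o` = r - 1 stands for -1, so the polynomial is X^(s+1) - 1 modulo r; its
    -- roots 1, ..., s + 2 are all below r.
    (¬tooManyRoots r-prime (suc s) (o ∷ replicate s 0) (cong suc (length-replicate s)) (<⇒≤ 2+s<r))
    where
    2+s<r : 2 + s < r
    2+s<r = s≤s (subst (_≤ o) (cong suc eq) (m%n<n e o))
    roots : ∀ {x} → 0 < x → x ≤ 2 + s → r ∣ o + x * eval (replicate s 0) x
    roots {x} 0<x x≤ with w , eq′ , r∣w ← remainder-annihilates 0<x (≤-<-trans x≤ 2+s<r) =
      subst (r ∣_) (begin
        r + w                              ≡⟨ +-suc o w ⟨
        o + suc w                          ≡⟨ cong (o +_) eq′ ⟨
        o + x ^ (e % o)                    ≡⟨ cong (λ y → o + x ^ y) eq ⟩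
        o + x * x ^ s                      ≡⟨ cong (λ y → o + x * y) (eval-zeros s x) ⟨
        o + x * eval (replicate s 0) x     ∎) (∣m∣n⇒∣m+n ∣-refl r∣w)
      where open ≡-Reasoning

∣^ : ∀ x {n} → 0 < n → x ∣ x ^ n
∣^ x {suc n} _ = m∣m*n (x ^ n)

-- A residue a modulo r is lifted to a unit modulo r * u by a * u ^ (r - 1) + r.
pred∣carmichael : ∀ {m r u} .{{_ : NonZero m}} → m ≡ r * u → Prime r → Coprime r u → pred r ∣ carmichael m
pred∣carmichael {r = r@(suc _)} {u} refl r-prime r⊥u = pred∣exponent r-prime λ {a} 0<a a<r → annihilates a 0<a a<r
  where
  instance
    u≢0 : NonZero u
    u≢0 = m*n≢0⇒n≢0 r
  0<pred : 0 < pred r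
  0<pred = <⇒≤pred (nonTrivial⇒n>1 r {{prime⇒nonTrivial r-prime}})
  annihilates : ∀ a → 0 < a → a < r → a ^ carmichael (r * u) ≡1[mod r ]
  annihilates a 0<a a<r with v , eq , r∣v ← fermat-unit {a = u} r-prime (coprime⇒∤ r⊥u r-prime ∣-refl) =
    %≡1⇒≡1 (m^n>0 a (carmichael (r * u))) (trans (^-cong-% (carmichael (r * u)) (sym b%r≡a%r))
      (≡1⇒%≡1 (≡1-∣ (m∣m*n u) (^carmichael≡1 b-unit))))
    where
    open ≡-Reasoning
    instance
      a≢0 : NonZero a
      a≢0 = >-nonZero 0<a
    -- Modulo r Fermat reduces this to a; modulo a prime factor of u only the summand r survives,
    -- and it is a unit there.
    b = a * u ^ pred r + r
    b%r≡a%r : b % r ≡ a % r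
    b%r≡a%r = begin
      (a * u ^ pred r + r) % r    ≡⟨ [m+n]%n≡m%n (a * u ^ pred r) r ⟩
      (a * u ^ pred r) % r        ≡⟨ cong (λ x → (a * x) % r) eq ⟩
      (a * suc v) % r             ≡⟨ cong (_% r) (*-suc a v) ⟩
      (a + a * v) % r             ≡⟨ %-remove-+ʳ a (∣n⇒∣m*n a r∣v) ⟩
      a % r                       ∎
    instance
      b≢0 : NonZero b
      b≢0 = >-nonZero (≤-trans z<s (m≤n+m r _))
    b⊥r : r ∤ b
    b⊥r r∣b = >⇒∤ a<r (m%n≡0⇒n∣m a r (trans (sym b%r≡a%r) (n∣m⇒m%n≡0 b r r∣b)))
    b⊥u : Coprime b u
    b⊥u = coprimeByPrimes λ l-prime l∣b l∣u → coprime⇒∤ r⊥u l-prime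
      (∣m+n∣m⇒∣n l∣b (∣n⇒∣m*n a (∣-trans l∣u (∣^ u 0<pred)))) l∣u
    b-unit : Coprime b (r * u)
    b-unit = coprime-*ʳ (Coprime.sym (prime∤⇒coprime r-prime b⊥r)) b⊥u

-- The numbers f m and d m

δ≡2 : ∀ {m} → 4 ∣ m → δ m ≡ 2
δ≡2 {m} 4∣m = cong (if_then 2 else 1) (dec-true (4 ∣? m) 4∣m)

δ≡1 : ∀ {m} → 4 ∤ m → δ m ≡ 1
δ≡1 {m} 4∤m = cong (if_then 2 else 1) (dec-false (4 ∣? m) 4∤m)

-- Here φ(m) = δ c φ(rad m), so the numerator δ t c φ(rad m) is t φ(m) and the division is exact.
-- Part (i) uses it with the odd number `c`, part (ii) with `c` = p.
f≡gcd : ∀ {m c t} .{{_ : NonZero m}} → m ≡ δ m * c * rad m → carmichael m ≡ t * c → f m ≡ gcd m t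
f≡gcd {m} {c} {t} m≡ λ≡ = cong (gcd m) (trans (/-congˡ {o = φ m} numerator) (m*n/n≡m t (φ m)))
  where
  instance _ = φ-nonZero m
  open ≡-Reasoning
  numerator : δ m * carmichael m * φ (rad m) ≡ t * φ m
  numerator = begin
    δ m * carmichael m * φ (rad m)    ≡⟨ cong (λ x → δ m * x * φ (rad m)) λ≡ ⟩
    δ m * (t * c) * φ (rad m)         ≡⟨ solve 4 (λ d t c r → d :* (t :* c) :* r := t :* (d :* c :* r)) refl (δ m) t c (φ (rad m)) ⟩
    t * (δ m * c * φ (rad m))         ≡⟨ cong (t *_) (φ-*-rad {k = δ m * c} m≡) ⟨
    t * φ m                           ∎

-- Part (i): evenness of f m

prime∣product-map : ∀ {p} (g : ℕ → ℕ) xs → Prime p → p ∣ product (map g xs) → ∃[ x ] x ∈ xs × p ∣ g x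
prime∣product-map g []       p-prime p∣1 = contradiction (∣1⇒≡1 p∣1) (prime⇒≢1 p-prime)
prime∣product-map g (x ∷ xs) p-prime p∣  with euclidsLemma (g x) _ p-prime p∣
... | inj₁ p∣gx = x , here refl , p∣gx
... | inj₂ p∣xs with y , y∈xs , p∣gy ← prime∣product-map g xs p-prime p∣xs = y , there y∈xs , p∣gy

two∣product-map : ∀ (g : ℕ → ℕ) {x y xs} → x ∈ xs → y ∈ xs → x ≢ y → g x * g y ∣ product (map g xs)
two∣product-map g (here refl) (here refl) x≢y = contradiction refl x≢y
two∣product-map g (here refl) (there y∈)  x≢y = *-monoʳ-∣ (g _) (∈⇒∣product (∈-map⁺ g y∈))
two∣product-map g {x} {y} {y ∷ xs} (there x∈) (here refl) x≢y =
  subst (_∣ g y * product (map g xs)) (*-comm (g y) (g x)) (*-monoʳ-∣ (g _) (∈⇒∣product (∈-map⁺ g x∈)))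
two∣product-map g (there x∈)  (there y∈)  x≢y = ∣n⇒∣m*n (g _) (two∣product-map g x∈ y∈ x≢y)

odd⇒2∣pred : ∀ {n} → 2 ∤ n → 2 ∣ pred n
odd⇒2∣pred 2∤n with h , refl ← odd-prime 2∤n = n∣m*n h

prime⇒1< : ∀ {p} → Prime p → 1 < p
prime⇒1< {p} p-prime = nonTrivial⇒n>1 p {{prime⇒nonTrivial p-prime}}

prime∤pred : ∀ {p q} → Prime p → q ≤ p → 1 < q → p ∤ pred q
prime∤pred {q = suc (suc _)} p-prime q≤p _ = >⇒∤ q≤p
prime∤pred {q = suc zero} p-prime q≤p (s≤s ())

d∣m : ∀ m → d m ∣ m
d∣m m = gcd[m,n]∣m m (δ m * φ (rad m))

d∣δφ : ∀ m → d m ∣ δ m * φ (rad m)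
d∣δφ m = gcd[m,n]∣n m (δ m * φ (rad m))

-- An odd prime factor s of d m divides t - 1 for some other odd prime factor t
-- of m, so 4 divides (s - 1)(t - 1) and hence φ (rad m).
8∤d⇒8∤m : ∀ {m s} .{{_ : NonZero m}} → Prime s → 2 ∤ s → s ∣ d m → 8 ∤ d m → 8 ∤ m
8∤d⇒8∤m {m} {s} s-prime 2∤s s∣d 8∤d 8∣m = 8∤d (gcd-greatest 8∣m (subst (λ x → 8 ∣ x * φ (rad m)) (sym δ≡) (*-monoʳ-∣ 2 4∣φ)))
  where
  δ≡ : δ m ≡ 2
  δ≡ = δ≡2 (∣-trans (divides 2 refl) 8∣m)

  s∣φ : s ∣ φ (rad m)
  s∣φ = coprime-divisor (prime∤⇒coprime s-prime (λ s∣2 → 2∤s (subst (2 ∣_) (sym (prime∣prime⇒≡ s-prime prime[2] s∣2)) ∣-refl)))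
    (subst (λ x → s ∣ x * φ (rad m)) δ≡ (∣-trans s∣d (d∣δφ m)))

  s∈ : s ∈ primeFactors m
  s∈ = ∈-primeFactors⁺ s-prime (∣-trans s∣d (d∣m m))

  4∣φ : 4 ∣ φ (rad m)
  4∣φ = 4∣φ′ (prime∣product-map pred (primeFactors m) s-prime (subst (s ∣_) (φ-rad m) s∣φ))
    where
    4∣φ′ : ∃[ t ] t ∈ primeFactors m × s ∣ pred t → 4 ∣ φ (rad m)
    4∣φ′ (t , t∈ , s∣t-1) = subst (4 ∣_) (sym (φ-rad m))
      (∣-trans (*-pres-∣ (odd⇒2∣pred 2∤s) (odd⇒2∣pred 2∤t)) (two∣product-map pred s∈ t∈ s≢t))
      where
      t-prime : Prime t
      t-prime = proj₁ (∈-primeFactors⁻ m t∈)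
      -- A prime t ≤ s has 0 < t - 1 < s, so s could not divide t - 1. Thus t exceeds s, which makes
      -- it odd and distinct from s.
      t≰s : t ≰ s
      t≰s t≤s = prime∤pred s-prime t≤s (prime⇒1< t-prime) s∣t-1
      2∤t : 2 ∤ t
      2∤t 2∣t = t≰s (subst (_≤ s) (prime∣prime⇒≡ prime[2] t-prime 2∣t) (prime⇒1< s-prime))
      s≢t : s ≢ t
      s≢t s≡t = t≰s (≤-reflexive (sym s≡t))

-- The power of 2 in `m` is 2 or 4, and `δ m` is half of it in both cases.
even∧8∤⇒ : ∀ {m} → 2 ∣ m → 8 ∤ m → ∃[ k ] 2 ∤ k × m ≡ δ m * (k * 2)
even∧8∤⇒ {m} (divides-refl j) 8∤m = case 4 ∣? m of λ where
  (yes 4∣m@(divides k m≡)) → k ,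
    (λ (divides h k≡) → 8∤m (divides h (trans m≡ (trans (cong (_* 4) k≡) (*-assoc h 2 4))))) ,
    trans m≡ (trans (solve 1 (λ k → k :* con 4 := con 2 :* (k :* con 2)) refl k) (cong (_* (k * 2)) (sym (δ≡2 4∣m))))
  (no 4∤m) → j ,
    (λ (divides h j≡) → 4∤m (divides h (trans (cong (_* 2) j≡) (*-assoc h 2 2)))) ,
    trans (sym (*-identityˡ (j * 2))) (cong (_* (j * 2)) (sym (δ≡1 4∤m)))

δ∣2 : ∀ m → δ m ∣ 2
δ∣2 m with does (4 ∣? m)
... | true  = ∣-refl
... | false = 1∣ 2

2∣f : ∀ {m} .{{_ : NonZero m}} → 2 < m → 2 ∣ m → 8 ∤ m → 2 ∣ f m
2∣f {m} 2<m 2∣m 8∤m = byOddPart (even∧8∤⇒ 2∣m 8∤m)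
  where
  byOddPart : ∃[ k ] 2 ∤ k × m ≡ δ m * (k * 2) → 2 ∣ f m
  byOddPart (k , 2∤k , m≡) = conclude (rad∣ m ⊑)
    where
    ⊑ : ∀ {p} → Prime p → p ∣ m → p ∣ k * 2
    ⊑ p-prime p∣m with euclidsLemma (δ m) (k * 2) p-prime (subst (_ ∣_) m≡ p∣m)
    ... | inj₁ p∣δ  = ∣-trans p∣δ (∣-trans (δ∣2 m) (n∣m*n k))
    ... | inj₂ p∣2k = p∣2k

    conclude : rad m ∣ k * 2 → 2 ∣ f m
    conclude (divides c 2k≡) = finish (cofactor∣carmichael 2∤c (divides (δ m) (trans m≡c
      (solve 3 (λ d c r → d :* c :* r := d :* (r :* c)) refl (δ m) c (rad m)))))
      where
      m≡c : m ≡ δ m * c * rad m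
      m≡c = trans m≡ (trans (cong (δ m *_) 2k≡) (sym (*-assoc (δ m) c (rad m))))

      -- Since rad m is even, an even `c` would give 4 ∣ c rad m = 2k.
      2∤c : 2 ∤ c
      2∤c 2∣c = 2∤k (*-cancelʳ-∣ 2 (subst (4 ∣_) (sym 2k≡) (*-pres-∣ 2∣c (prime∣⇒∣rad prime[2] 2∣m))))

      finish : c ∣ carmichael m → 2 ∣ f m
      finish (divides t λ≡) = subst (2 ∣_) (sym (f≡gcd {m} {c} {t} m≡c λ≡)) (gcd-greatest 2∣m 2∣t)
        where
        2∣t : 2 ∣ t
        2∣t with euclidsLemma t c prime[2] (subst (2 ∣_) λ≡ (2∣carmichael 2<m))
        ... | inj₁ 2∣t = 2∣t
        ... | inj₂ 2∣c = contradiction 2∣c 2∤c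

odd∣d⇒2∣f : ∀ {m n} .{{_ : NonZero m}} → 1 < n → 2 ∤ n → n ∣ d m → 2 ∣ d m → 8 ∤ d m → 2 ∣ f m
odd∣d⇒2∣f {m} {n} 1<n 2∤n n∣d 2∣d 8∤d = byPrime (primeDivisor (>⇒≢ 1<n))
  where
  byPrime : ∃[ s ] Prime s × s ∣ n → 2 ∣ f m
  byPrime (s , s-prime , s∣n) = 2∣f (<-≤-trans 2<s (∣⇒≤ (∣-trans s∣d (d∣m m)))) (∣-trans 2∣d (d∣m m)) (8∤d⇒8∤m s-prime 2∤s s∣d 8∤d)
    where
    s∣d : s ∣ d m
    s∣d = ∣-trans s∣n n∣d
    2∤s : 2 ∤ s
    2∤s 2∣s = 2∤n (∣-trans 2∣s s∣n)
    2<s : 2 < s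
    2<s = ≤∧≢⇒< (prime⇒1< s-prime) (λ 2≡s → 2∤s (∣-reflexive 2≡s))

noModulus : ∀ n → 1 < n → 2 ∤ n → ∀ k → 2 ∣ k → 8 ∤ k * n →
        ¬ (∃[ m ] Σ[ m≢0 ∈ NonZero m ] (f m {{m≢0}} , d m) ≡ (n , k * n))
noModulus n 1<n 2∤n k 2∣k 8∤kn (m , m≢0 , eq) = 2∤n (subst (2 ∣_) (cong proj₁ eq)
  (odd∣d⇒2∣f {{m≢0}} 1<n 2∤n (subst (n ∣_) (sym d≡) (n∣m*n k)) (subst (2 ∣_) (sym d≡) (∣m⇒∣m*n n 2∣k))
    (λ 8∣d → 8∤kn (subst (8 ∣_) d≡ 8∣d))))
  where
  d≡ : d m ≡ k * n
  d≡ = cong proj₂ eq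

-- Part (ii): the modulus p²qr

≡1-^* : ∀ {m} a x y → a ^ x ≡1[mod m ] → a ^ (x * y) ≡1[mod m ]
≡1-^* {m} a x y a^x≡1 = subst (_≡1[mod m ]) (^-*-assoc a x y) (≡1-^ y a^x≡1)

module Witness {p q r A B : ℕ} (p-prime : Prime p) (q-prime : Prime q) (r-prime : Prime r)
  (2∤p : 2 ∤ p) (p<q : p < q) (q<r : q < r)
  (q-1≡ : pred q ≡ A * p) (r-1≡ : pred r ≡ B * q) (p∤A : p ∤ A) (p∤B : p ∤ B) where

  private
    ps : List ℕ
    ps = p ∷ q ∷ r ∷ []

    ps-prime : All Prime ps
    ps-prime = p-prime ∷ q-prime ∷ r-prime ∷ []

    ps-unique : Unique ps
    ps-unique = (<⇒≢ p<q ∷ <⇒≢ (<-trans p<q q<r) ∷ []) ∷ (<⇒≢ q<r ∷ []) ∷ [] ∷ []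

    -- `E` is φ(rad m) without the factor qp. Once the common factors are taken out, both gcds are
    -- decided by `E` being coprime to p and r.
    P E : ℕ
    P = product ps
    E = pred p * (A * B)

    instance
      p≢0 : NonZero p
      p≢0 = prime⇒nonZero p-prime
      q≢0 : NonZero q
      q≢0 = prime⇒nonZero q-prime
      r≢0 : NonZero r
      r≢0 = prime⇒nonZero r-prime
      P≢0 : NonZero P
      P≢0 = productOfPrimes≢0 ps-prime

  m : ℕ
  m = q * p * (p * r)

  m≢0 : NonZero m
  m≢0 = m*n≢0 (q * p) (p * r) {{m*n≢0 q p}} {{m*n≢0 p r}}

  private
    instance _ = m≢0

    m≡pP : m ≡ p * P
    m≡pP = solve 3 (λ p q r → q :* p :* (p :* r) := p :* (p :* (q :* (r :* con 1)))) refl p q r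

    rad≡P : rad m ≡ P
    rad≡P = ∣-antisym (rad∣ m m⊑P)
      (product∣ ps-unique ps-prime (All.map (λ {x} (x-prime , x∣P) → prime∣⇒∣rad x-prime (∣P⇒∣m x∣P))
        (All.tabulate λ x∈ → All.lookup ps-prime x∈ , ∈⇒∣product x∈)))
      where
      ∣P⇒∣m : ∀ {x} → x ∣ P → x ∣ m
      ∣P⇒∣m x∣P = ∣-trans x∣P (subst (P ∣_) (sym m≡pP) (n∣m*n p))
      m⊑P : ∀ {l} → Prime l → l ∣ m → l ∣ P
      m⊑P {l} l-prime l∣m with euclidsLemma p P l-prime (subst (l ∣_) m≡pP l∣m)
      ... | inj₁ l∣p = ∣m⇒∣m*n _ l∣p
      ... | inj₂ l∣P = l∣P

    φ-rad≡ : φ (rad m) ≡ q * p * E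
    φ-rad≡ = begin
      φ (rad m)                                ≡⟨ cong φ rad≡P ⟩
      φ P                                      ≡⟨ φ-product ps-unique ps-prime ⟩
      pred p * (pred q * (pred r * 1))         ≡⟨ cong₂ (λ x y → pred p * (x * (y * 1))) q-1≡ r-1≡ ⟩
      pred p * (A * p * (B * q * 1))           ≡⟨ solve 5 (λ p′ p q A B → p′ :* (A :* p :* (B :* q :* con 1)) := q :* p :* (p′ :* (A :* B))) refl (pred p) p q A B ⟩
      q * p * E                                ∎
      where open ≡-Reasoning

    p⊥E : Coprime p E
    p⊥E = coprime-*ʳ (prime∤⇒coprime p-prime (prime∤pred p-prime ≤-refl (prime⇒1< p-prime)))
      (coprime-*ʳ (prime∤⇒coprime p-prime p∤A) (prime∤⇒coprime p-prime p∤B))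

    -- As the largest of the three primes, `r` cannot divide p - 1, q - 1 or r - 1.
    r⊥E : Coprime r E
    r⊥E = coprime-*ʳ (r⊥ p-prime (<⇒≤ (<-trans p<q q<r)) ∣-refl)
      (coprime-*ʳ (r⊥ q-prime (<⇒≤ q<r) (subst (A ∣_) (sym q-1≡) (m∣m*n p)))
                  (r⊥ r-prime ≤-refl (subst (B ∣_) (sym r-1≡) (m∣m*n q))))
      where
      r⊥ : ∀ {l x} → Prime l → l ≤ r → x ∣ pred l → Coprime r x
      r⊥ l-prime l≤r x∣ = prime∤⇒coprime r-prime
        (λ r∣x → prime∤pred r-prime l≤r (prime⇒1< l-prime) (∣-trans r∣x x∣))

    p⊥q : Coprime p q
    p⊥q = prime∤⇒coprime p-prime (λ p∣q → <⇒≢ p<q (prime∣prime⇒≡ p-prime q-prime p∣q))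

    r⊥pq : Coprime r (q * p)
    r⊥pq = coprime-*ʳ (r⊥ q-prime q<r) (r⊥ p-prime (<-trans p<q q<r))
      where
      r⊥ : ∀ {l} → Prime l → l < r → Coprime r l
      r⊥ l-prime l<r = prime∤⇒coprime r-prime
        (λ r∣l → <⇒≢ l<r (sym (prime∣prime⇒≡ r-prime l-prime r∣l)))

    r⊥pqp : Coprime r (q * p * p)
    r⊥pqp = coprime-*ʳ r⊥pq (coprime-∣ʳ (n∣m*n q) r⊥pq)

    -- The exponents p(p - 1), q - 1 = A p and r - 1 = B q for the moduli p², q and r all divide q p
    -- E. A single factor p serves the first two, which is why λ(m) contains p only once.
    carmichael∣φ-rad : carmichael m ∣ q * p * E
    carmichael∣φ-rad = carmichael∣ λ {a} a⊥m → subst (a ^ (q * p * E) ≡1[mod_])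
      (solve 3 (λ p q r → p :* p :* (q :* r) := q :* p :* (p :* r)) refl p q r)
      (≡1-coprime
        (coprime-*ˡ p⊥qr p⊥qr)
        (subst (λ e → a ^ e ≡1[mod p * p ])
            (solve 5 (λ p′ p q A B → p′ :* p :* (q :* A :* B) := q :* p :* (p′ :* (A :* B))) refl (pred p) p q A B)
          (≡1-^* a (pred p * p) (q * A * B) (subst (_≡1[mod p * p ]) (^-*-assoc a (pred p) p)
            (≡1-^prime p-prime (fermat-unit p-prime (∤a a⊥m p-prime (∣m⇒∣m*n (p * r) (n∣m*n q))))))))
        (≡1-coprime
          (Coprime.sym (coprime-∣ʳ (m∣m*n p) r⊥pq))
          (subst (λ e → a ^ e ≡1[mod q ]) (trans (cong (_* (pred p * q * B)) q-1≡)
              (solve 5 (λ p′ p q A B → A :* p :* (p′ :* q :* B) := q :* p :* (p′ :* (A :* B))) refl (pred p) p q A B))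
            (≡1-^* a (pred q) (pred p * q * B) (fermat-unit q-prime (∤a a⊥m q-prime (∣m⇒∣m*n (p * r) (m∣m*n p))))))
          (subst (λ e → a ^ e ≡1[mod r ]) (trans (cong (_* (pred p * p * A)) r-1≡)
              (solve 5 (λ p′ p q A B → B :* q :* (p′ :* p :* A) := q :* p :* (p′ :* (A :* B))) refl (pred p) p q A B))
            (≡1-^* a (pred r) (pred p * p * A) (fermat-unit r-prime (∤a a⊥m r-prime (∣n⇒∣m*n (q * p) (n∣m*n p))))))))
      where
      p⊥qr : Coprime p (q * r)
      p⊥qr = coprime-*ʳ p⊥q (Coprime.sym (coprime-∣ʳ (n∣m*n q) r⊥pq))
      ∤a : ∀ {a l} → Coprime a m → Prime l → l ∣ m → l ∤ a
      ∤a a⊥m l-prime l∣m l∣a = coprime⇒∤ a⊥m l-prime l∣a l∣m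

    -- The factor q comes from r - 1 = B q; the factor p is the cofactor of rad m in m.
    qp∣carmichael : q * p ∣ carmichael m
    qp∣carmichael = coprime∧∣⇒*∣ (Coprime.sym p⊥q)
      (∣-trans (subst (q ∣_) (sym r-1≡) (n∣m*n B))
        (pred∣carmichael (solve 3 (λ p q r → q :* p :* (p :* r) := r :* (q :* p :* p)) refl p q r) r-prime r⊥pqp))
      (cofactor∣carmichael 2∤p (subst (λ x → x * p ∣ m) (sym rad≡P) (∣-reflexive (trans (*-comm P p) (sym m≡pP)))))

    δ≡ : δ m ≡ 1
    δ≡ = δ≡1 λ 4∣m → 2∤ (∣-trans (divides 2 refl) 4∣m)
      where
      2∤prime : ∀ {l} → Prime l → 2 < l → 2 ∤ l
      2∤prime l-prime 2<l 2∣l = <⇒≢ 2<l (prime∣prime⇒≡ prime[2] l-prime 2∣l)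
      2<q = ≤-<-trans (prime⇒1< p-prime) p<q
      2∤ : 2 ∤ m
      2∤ 2∣m = coprime⇒∤
        (coprime-*ʳ (coprime-*ʳ (2⊥ (2∤prime q-prime 2<q)) (2⊥ 2∤p)) (coprime-*ʳ (2⊥ 2∤p) (2⊥ (2∤prime r-prime (<-trans 2<q q<r)))))
        prime[2] ∣-refl 2∣m
        where
        2⊥ : ∀ {x} → 2 ∤ x → Coprime 2 x
        2⊥ = prime∤⇒coprime prime[2]

  d≡ : d m ≡ p * q
  d≡ = begin
    gcd m (δ m * φ (rad m))            ≡⟨ cong₂ (λ x y → gcd m (x * y)) δ≡ φ-rad≡ ⟩
    gcd m (1 * (q * p * E))            ≡⟨ cong (gcd m) (*-identityˡ (q * p * E)) ⟩
    gcd (q * p * (p * r)) (q * p * E)  ≡⟨ c*gcd[m,n]≡gcd[cm,cn] (q * p) (p * r) E ⟨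
    q * p * gcd (p * r) E              ≡⟨ cong (q * p *_) (Coprime.coprime⇒gcd≡1 (coprime-*ˡ p⊥E r⊥E)) ⟩
    q * p * 1                          ≡⟨ trans (*-identityʳ (q * p)) (*-comm q p) ⟩
    p * q                              ∎
    where open ≡-Reasoning

  f≡ : f m {{m≢0}} ≡ q
  f≡ = f≡′ qp∣carmichael
    where
    f≡′ : q * p ∣ carmichael m → f m ≡ q
    f≡′ (divides t λ≡) = begin
      f m                                ≡⟨ f≡gcd {m} {p} {q * t} m≡ (trans λ≡ (solve 3 (λ t p q → t :* (q :* p) := q :* t :* p) refl t p q)) ⟩
      gcd m (q * t)                      ≡⟨ cong (λ x → gcd x (q * t)) (*-assoc q p (p * r)) ⟩
      gcd (q * (p * (p * r))) (q * t)    ≡⟨ c*gcd[m,n]≡gcd[cm,cn] q (p * (p * r)) t ⟨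
      q * gcd (p * (p * r)) t            ≡⟨ cong (q *_) (Coprime.coprime⇒gcd≡1 (coprime-∣ʳ t∣E (coprime-*ˡ p⊥E (coprime-*ˡ p⊥E r⊥E)))) ⟩
      q * 1                              ≡⟨ *-identityʳ q ⟩
      q                                  ∎
      where
      open ≡-Reasoning
      m≡ : m ≡ δ m * p * rad m
      m≡ = trans m≡pP (cong₂ _*_ (trans (sym (*-identityˡ p)) (cong (_* p) (sym δ≡))) (sym rad≡P))
      -- λ(m) = t q p divides q p E, so `t` inherits from `E` that it is coprime to p and r.
      t∣E : t ∣ E
      t∣E = *-cancelˡ-∣ (q * p) {{m*n≢0 q p}} (subst (_∣ q * p * E) (trans λ≡ (*-comm t (q * p))) carmichael∣φ-rad)

theorem1p4 : ((n : ℕ) → 1 < n → 2 ∤ n →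
    (¬ (∃[ m ] Σ[ m≢0 ∈ NonZero m ] (f m {{m≢0}} , d m) ≡ (n , 2 * n)))
    × (¬ (∃[ m ] Σ[ m≢0 ∈ NonZero m ] (f m {{m≢0}} , d m) ≡ (n , 4 * n))))
    × ((L : ℝ) → IsLinnikConstant L →
    ∃[ C ] Positive C ×
    ((p q : ℕ) → Prime p → Prime q → 2 ∤ p → 2 ∤ q →
    p < q → p ∣ q ∸ 1 → p * p ∤ q ∸ 1 →
    ∃[ m ] Σ[ m≢0 ∈ NonZero m ]
    m ≤ᵣ (p ⊛ C) · (p * q) ^ᵣ (L ⊕ 1)
    × f m {{m≢0}} ≡ q × d m ≡ p * q))
theorem1p4 = noneWithFactor , λ L (L>0 , c , c>0 , linnik) → c , c>0 , construct L L>0 c linnik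
  where
  noneWithFactor : ∀ n → 1 < n → 2 ∤ n → _ × _
  noneWithFactor n 1<n 2∤n =
    noModulus n 1<n 2∤n 2 ∣-refl (λ 8∣2n → 2∤n (*-cancelˡ-∣ 2 (∣-trans (divides 2 refl) 8∣2n))) ,
    noModulus n 1<n 2∤n 4 (divides 2 refl) (λ 8∣4n → 2∤n (*-cancelˡ-∣ 4 8∣4n))

  construct : ∀ L → Positive L → ∀ c →
    (∀ a q → 1 ≤ a → a < q → Coprime a q → ∃[ P ] IsLeastPrimeIn a q P × P ≤ᵣ c · q ^ᵣ L) →
    (p q : ℕ) → Prime p → Prime q → 2 ∤ p → 2 ∤ q → p < q → p ∣ q ∸ 1 → p * p ∤ q ∸ 1 →
    ∃[ m ] Σ[ m≢0 ∈ NonZero m ] m ≤ᵣ (p ⊛ c) · (p * q) ^ᵣ (L ⊕ 1) × f m {{m≢0}} ≡ q × d m ≡ p * q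
  construct L L>0 c linnik p q@(suc o) p-prime q-prime 2∤p 2∤q p<q (divides A q-1≡) p²∤
    = finish (linnik (1 + q) (p * q) (s≤s z≤n) 1+q<pq
        (coprime-*ʳ (Coprime.sym (prime∤⇒coprime p-prime p∤1+q)) (Coprime.sym (∣⇒coprime-1+ ∣-refl))))
    where
    instance _ = prime⇒nonZero p-prime

    1+q<pq : 1 + q < p * q
    1+q<pq = begin-strict
      1 + q    <⟨ +-monoˡ-< q (prime⇒1< q-prime) ⟩
      q + q    ≡⟨ cong (q +_) (+-identityʳ q) ⟨
      2 * q    ≤⟨ *-monoˡ-≤ q (prime⇒1< p-prime) ⟩
      p * q    ∎
      where open ≤-Reasoning

    -- With q = 1 + A p the sum is 2 + A p, and `p` is odd.
    p∤1+q : p ∤ 1 + q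
    p∤1+q p∣1+q = 2∤p (∣-reflexive (sym (prime∣prime⇒≡ p-prime prime[2]
      (∣m+n∣m⇒∣n (subst (p ∣_) (trans (cong (2 +_) q-1≡) (+-comm 2 (A * p))) p∣1+q) (n∣m*n A)))))

    finish : ∃[ r ] IsLeastPrimeIn (1 + q) (p * q) r × r ≤ᵣ c · p * q ^ᵣ L →
             ∃[ m ] Σ[ m≢0 ∈ NonZero m ] m ≤ᵣ (p ⊛ c) · (p * q) ^ᵣ (L ⊕ 1) × f m {{m≢0}} ≡ q × d m ≡ p * q
    finish (r , (r-prime , (j , r≡) , _) , r≤) = Ex.m , Ex.m≢0 ,
      subst (_≤ᵣ p ⊛ c · p * q ^ᵣ (L ⊕ 1))
        (solve 3 (λ p q r → p :* q :* p :* r := q :* p :* (p :* r)) refl p q r)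
        (≤ᵣ-scale {x = c} {y = L} p L>0 r≤) ,
      Ex.f≡ , Ex.d≡
      where
      -- From r = 1 + q + j p q one gets r - 1 = (1 + j p) q, so B = 1 + j p is 1 modulo p.
      module Ex = Witness {p} {q} {r} {A} {1 + j * p} p-prime q-prime r-prime 2∤p p<q
        (subst (q <_) (sym r≡) (s≤s (m≤m+n q _)))
        q-1≡
        (trans (cong pred r≡) (solve 3 (λ p q j → q :+ j :* (p :* q) := (con 1 :+ j :* p) :* q) refl p q j))
        (λ p∣A → p²∤ (subst (p * p ∣_) (sym q-1≡) (*-monoˡ-∣ p p∣A)))
        (λ p∣1+jp → prime⇒≢1 p-prime (∣⇒coprime-1+ (n∣m*n j) (∣-refl , p∣1+jp)))
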